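{- Let $T=\{1342,2134,2413\}$. Then $$F_T(x)=\frac{(1-x)(1-2x)(1-3x)}{1-7x+16x^2-14x^3+3x^4}.$$
   Context: $S_n(T)$ denotes the set of permutations $\pi$ of $[n]=\{1,\dots,n\}$ (one-line notation) that avoid every pattern $\tau\in T$, i.e. no subsequence of $\pi$ is order-isomorphic to $\tau$. $F_T(x)=\sum_{n\ge 0}|S_n(T)|x^n$, a formal power series, with $|S_0(T)|=1$. -}

module Defs where

open import Data.Nat.Base as ℕ using (ℕ; zero; suc; _∸_)
import Data.Nat.Properties as ℕ
open import Data.Integer.Base using (ℤ; +_; 0ℤ; 1ℤ) renaming (_*_ to _*ℤ_; _-_ to _-ℤ_; _+_ to _+ℤ_)
import Data.Integer.Properties as ℤ
open import Data.Integer.Tactic.RingSolver using (solve-∀)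
open import Data.Fin.Base using (Fin; toℕ) renaming (_<_ to _<ᶠ_)
import Data.Fin.Properties as Fin
open import Data.Vec.Base as Vec using (Vec; []; _∷_; lookup)
import Data.Vec.Properties as Vec
open import Data.Vec.Relation.Unary.AllPairs using (AllPairs; allPairs?)
open import Data.List.Base as List using (List; []; _∷_; allFin; cartesianProductWith; filter; length)
open import Data.List.Membership.Propositional using (_∈_; lose)
open import Data.List.Membership.Propositional.Properties
  using (∈-allFin; ∈-cartesianProductWith⁺; ∈-filter⁺; ∈-filter⁻)
open import Data.List.Relation.Unary.All as All using (All)
open import Data.List.Relation.Unary.Any as Any using (Any; here; satisfied)
open import Data.List.Relation.Unary.AllPairs as AllPairs using ([]; _∷_)
open import Data.List.Relation.Unary.Unique.Propositional using (Unique)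
import Data.List.Relation.Unary.Unique.Propositional.Properties as Unique
open import Data.Product.Base using (∃; _×_; _,_; proj₂)
open import Function.Base using (_∘_)
open import Function.Bundles using (_⇔_; mk⇔; Equivalence)
open import Function.Definitions using (Bijective)
open import Relation.Binary.PropositionalEquality
  using (_≡_; _≗_; refl; cong; cong₂; module ≡-Reasoning)
open import Relation.Nullary using (¬_; Dec; ¬?; _×-dec_; _→-dec_; map′)
open import Relation.Unary using (Decidable)

open import Algebra.Properties.Monoid.Sum ℤ.+-0-monoid using (sum)

private variable
  k n : ℕ

Word : ℕ → ℕ → Set
Word m n = Vec (Fin m) n

-- One-line notation.  The letters are 0, …, n-1 instead of 1, …, n.
IsPermutation : Word n n → Set
IsPermutation π = Bijective _≡_ _≡_ (lookup π)

OrderIsomorphic : Vec ℕ k → Vec ℕ k → Set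
OrderIsomorphic u v =
  ∀ i j → (lookup u i ℕ.< lookup u j) ⇔ (lookup v i ℕ.< lookup v j)

subsequence : Word n n → Vec (Fin n) k → Vec ℕ k
subsequence π = Vec.map (toℕ ∘ lookup π)

Occurrence : Vec ℕ k → Word n n → Vec (Fin n) k → Set
Occurrence τ π ι = AllPairs _<ᶠ_ ι × OrderIsomorphic (subsequence π ι) τ

Contains : Word n n → Vec ℕ k → Set
Contains π τ = ∃ (Occurrence τ π)

-- A pattern is only used up to order isomorphism, so it may be written
-- with the letters 1, …, k.
Pattern : Set
Pattern = ∃ (Vec ℕ)

Avoids : Word n n → Pattern → Set
Avoids π (_ , τ) = ¬ Contains π τ

InS : List Pattern → Word n n → Set
InS T π = IsPermutation π × All (Avoids π) T

words : ∀ m n → List (Word m n)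
words m zero    = [] ∷ []
words m (suc n) = cartesianProductWith _∷_ (allFin m) (words m n)

∈-words : ∀ {m n} (w : Word m n) → w ∈ words m n
∈-words []      = here refl
∈-words (x ∷ w) = ∈-cartesianProductWith⁺ _∷_ (∈-allFin x) (∈-words w)

words-unique : ∀ m n → Unique (words m n)
words-unique m zero    = All.[] ∷ []
words-unique m (suc n) =
  Unique.cartesianProductWith⁺ _∷_ Vec.∷-injective
    (Unique.allFin⁺ m) (words-unique m n)

private
  ∃-word? : ∀ {m n} {P : Word m n → Set} → Decidable P → Dec (∃ P)
  ∃-word? P? = map′ satisfied (λ (w , p) → lose (∈-words w) p)
                    (Any.any? P? (words _ _))

  _⇔-dec_ : {A B : Set} → Dec A → Dec B → Dec (A ⇔ B)
  a? ⇔-dec b? =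
    map′ (λ (f , g) → mk⇔ f g) (λ e → Equivalence.to e , Equivalence.from e)
         ((a? →-dec b?) ×-dec (b? →-dec a?))

isPermutation? : Decidable (IsPermutation {n})
isPermutation? π =
  map′ (λ f {x} {y} → f x y) (λ f x y → f {x} {y})
    (Fin.all? λ x → Fin.all? λ y →
      (lookup π x Fin.≟ lookup π y) →-dec (x Fin.≟ y))
  ×-dec
  Fin.all? λ y → map′
    (λ (x , eq) → x , λ { refl → eq })
    (λ (x , eq) → x , eq refl)
    (Fin.any? λ x → lookup π x Fin.≟ y)

orderIsomorphic? : (u v : Vec ℕ k) → Dec (OrderIsomorphic u v)
orderIsomorphic? u v = Fin.all? λ i → Fin.all? λ j →
  (lookup u i ℕ.<? lookup u j) ⇔-dec (lookup v i ℕ.<? lookup v j)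

contains? : (π : Word n n) (τ : Vec ℕ k) → Dec (Contains π τ)
contains? π τ = ∃-word? λ ι →
  allPairs? Fin._<?_ ι ×-dec orderIsomorphic? (subsequence π ι) τ

inS? : (T : List Pattern) → Decidable (InS {n} T)
inS? T π = isPermutation? π ×-dec All.all? (λ τ → ¬? (contains? π (proj₂ τ))) T

S : ∀ n → List Pattern → List (Word n n)
S n T = filter (inS? T) (words n n)

-- S n T lists every permutation avoiding T exactly once, so its length
-- is the cardinality |S_n(T)|.
∈-S : ∀ {T} {π : Word n n} → (π ∈ S n T) ⇔ InS T π
∈-S {T = T} {π} =
  mk⇔ (λ π∈ → proj₂ (∈-filter⁻ (inS? T) {xs = words _ _} π∈))
      (∈-filter⁺ (inS? T) (∈-words π))

S-unique : ∀ n T → Unique (S n T)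
S-unique n T = Unique.filter⁺ (inS? T) (words-unique n n)

PowerSeries : Set
PowerSeries = ℕ → ℤ

infix  4 _≈_
infixl 7 _*_

_≈_ : PowerSeries → PowerSeries → Set
f ≈ g = f ≗ g

_*_ : PowerSeries → PowerSeries → PowerSeries
(f * g) n = sum {suc n} λ i → f (toℕ i) *ℤ g (n ∸ toℕ i)

polynomial : List ℤ → PowerSeries
polynomial []       _       = 0ℤ
polynomial (a ∷ as) zero    = a
polynomial (a ∷ as) (suc n) = polynomial as n

-- The quotient f / g, by long division: with g = 1 + x g′ and
-- f = f₀ + x f′, one has f / g = f₀ + x ((f′ - f₀ g′) / g).
divide : (f g : PowerSeries) → g 0 ≡ 1ℤ → PowerSeries
divide f g g₀≡1 zero    = f 0
divide f g g₀≡1 (suc n) =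
  divide (λ i → f (suc i) -ℤ f 0 *ℤ g (suc i)) g g₀≡1 n

divide-* : ∀ f g (g₀≡1 : g 0 ≡ 1ℤ) → divide f g g₀≡1 * g ≈ f
divide-* f g g₀≡1 zero = begin
  f 0 *ℤ g 0 +ℤ 0ℤ  ≡⟨ ℤ.+-identityʳ _ ⟩
  f 0 *ℤ g 0        ≡⟨ cong (f 0 *ℤ_) g₀≡1 ⟩
  f 0 *ℤ 1ℤ         ≡⟨ ℤ.*-identityʳ _ ⟩
  f 0               ∎
  where open ≡-Reasoning
divide-* f g g₀≡1 (suc n) = begin
  f 0 *ℤ g (suc n) +ℤ (divide f′ g g₀≡1 * g) n
    ≡⟨ cong (f 0 *ℤ g (suc n) +ℤ_) (divide-* f′ g g₀≡1 n) ⟩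
  f 0 *ℤ g (suc n) +ℤ (f (suc n) -ℤ f 0 *ℤ g (suc n))
    ≡⟨ cancel (f 0 *ℤ g (suc n)) (f (suc n)) ⟩
  f (suc n) ∎
  where
  open ≡-Reasoning
  f′ : PowerSeries
  f′ i = f (suc i) -ℤ f 0 *ℤ g (suc i)
  cancel : ∀ a b → a +ℤ (b -ℤ a) ≡ b
  cancel = solve-∀

F : List Pattern → PowerSeries
F T n = + length (S n T)

{-# OPTIONS --safe #-}
-- Decompose π by its first letter x.  Call the letters above x high and the
-- letters below x low.  Avoiding 1342, 2134 and 2413 forces the rest of π to be
-- either  us ++ low  with us high, or  us ++ p ++ ds ++ q  with us, ds high,
-- p, q low and p, ds nonempty.
--   In the first case us is any {231 , 2134}-avoider and low any member of the
-- class.  In the second case us avoids {231 , 213}, ds is a decreasing sequence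
-- above us, and replacing ds by the single letter x leaves a member p ++ x ∷ q
-- of the class whose first letter is not its maximum.
--   With α the counting sequence this gives
--   α (n + 1) = Σ_{x ≤ n} α x · V (n - x) + (α (x + 1) - α x) · P (n - x),
-- where V counts the {231 , 2134}-avoiders and P (m + 1) = 2 ^ m.  Both V and P
-- satisfy linear recurrences, so the convolutions can be eliminated.
module Submission where

open import Defs
open import Data.Integer.Base using (+_; -_)
open import Data.List.Base using (List; []; _∷_)
open import Data.Vec.Base using ([]; _∷_)
open import Data.Product.Base using (_,_)
open import Relation.Binary.PropositionalEquality using (refl)

open import Data.Nat.Base as ℕ
  using (ℕ; zero; suc; _+_; _∸_; _^_; _≤_; _<_; _>_; z≤n; s≤s; z<s; s<s; s≤s⁻¹)
import Data.Nat.Properties as ℕ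
open import Data.Integer.Base using (ℤ; 0ℤ; 1ℤ)
  renaming (_*_ to _*ℤ_; _-_ to _-ℤ_; _+_ to _+ℤ_)
import Data.Integer.Properties as ℤ
open import Data.Integer.Tactic.RingSolver using (solve-∀)
open import Data.Fin.Base using (Fin; zero; suc; toℕ; fromℕ<) renaming (_<_ to _<ᶠ_)
import Data.Fin.Properties as Fin
open import Data.Vec.Base as Vec using (Vec; lookup)
import Data.Vec.Properties as Vec
open import Data.Vec.Relation.Unary.AllPairs as VecPairs using ([]; _∷_)
import Data.Vec.Relation.Unary.AllPairs.Properties as VecPairs
open import Data.Vec.Relation.Unary.All as VecAll using ([]; _∷_)
import Data.Vec.Relation.Unary.All.Properties as VecAll
open import Data.List.Base
  using ([_]; _++_; length; map; filter; cartesianProduct; tabulate; upTo)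
open import Data.List.Properties
  using (length-++; length-map; length-upTo; ∷-injective; filter-all; filter-none;
         filter-++; ++-identityʳ; ++-assoc; map-++; map-id-local)
open import Data.List.Membership.Propositional using (_∈_; _∉_)
open import Data.List.Membership.DecPropositional ℕ._≟_ using (_∈?_)
open import Data.List.Membership.Propositional.Properties
  using (∈-++⁺ˡ; ∈-++⁺ʳ; ∈-++⁻; ∈-map⁺; ∈-map⁻; ∈-filter⁺; ∈-filter⁻; ∈-∃++;
         ∈-cartesianProduct⁺; ∈-cartesianProduct⁻; ∈-tabulate⁺; ∈-tabulate⁻; ∈-upTo⁺; ∈-upTo⁻)
open import Data.List.Relation.Unary.All as All using (All; []; _∷_)
import Data.List.Relation.Unary.All.Properties as All
open import Data.List.Relation.Unary.Any using (here; there)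
open import Data.List.Relation.Unary.AllPairs using (AllPairs; []; _∷_)
open import Data.List.Relation.Unary.Unique.Propositional using (Unique)
import Data.List.Relation.Unary.Unique.Propositional.Properties as Unique
open import Data.List.Relation.Binary.Sublist.Propositional
  using (_⊆_; []; _∷_; _∷ʳ_; ⊆-refl; ⊆-trans; from∈; to∈; minimum)
open import Data.List.Relation.Binary.Sublist.Propositional.Properties
  using (All-resp-⊆; filter⁺; ++⁺; ++⁺ˡ; ++⁺ʳ; ∷ˡ⁻) renaming (map⁺ to ⊆-map⁺)
open import Data.List.Relation.Binary.Permutation.Propositional
  using (_↭_; ↭-sym; ↭-trans; prep; ↭⇒↭ₛ)
import Data.List.Relation.Binary.Permutation.Propositional.Properties as ↭
open import Data.Product.Base using (∃; ∃₂; _×_; proj₁; proj₂)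
open import Data.Sum.Base using (_⊎_; inj₁; inj₂; [_,_]′)
open import Data.Empty using (⊥-elim)
open import Function.Base using (_∘_; id; case_of_)
open import Function.Bundles using (mk⇔; Equivalence)
open import Relation.Binary.PropositionalEquality hiding ([_]; refl)
open import Relation.Binary.Definitions using (tri<; tri≈; tri>)
open import Relation.Nullary using (¬_; Dec; yes; no; ¬?; contradiction)
open import Relation.Unary using (Decidable)
import Data.List.Relation.Binary.Permutation.Setoid.Properties (setoid ℕ) as ↭ₛ
open import Algebra.Properties.Monoid.Sum ℤ.+-0-monoid using (sum)

-- A block of a permutation is not itself a permutation of an initial segment, so the argument runs
-- over lists of naturals that arrange an interval `[a , b)`. Blocks then keep their actual letters
-- and are never standardised; words return only at the end. The shape behind the first letter `x`
-- comes from `x` and the first low letter `y`. Two later high letters that increase complete `x`,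
-- `y` to 2134, and a high, a low and then a smaller high letter complete `x` to 2413. Hence the
-- high letters behind `y` form a single decreasing block. The place of that block among the low
-- letters is free, so the collapsed words are counted by complement: of the `α (x + 1)` members,
-- those with the maximum in front number `α x`. This brings the unknown sequence into the
-- recurrence a second time, through its differences.

private variable
  A B : Set
  P Q : A → Set
  a b c d f k l m n x y : ℕ
  xs ys zs lo up us ds low p q : List ℕ

-- Finite enumerations

record Card {A : Set} (P : A → Set) (k : ℕ) : Set where
  constructor card
  field
    elements : List A
    unique   : Unique elements
    sound    : ∀ {x} → x ∈ elements → P x
    complete : ∀ {x} → P x → x ∈ elements
    size     : length elements ≡ k

length-⊆ : {xs ys : List A} → Unique xs → (∀ {x} → x ∈ xs → x ∈ ys) → length xs ≤ length ys
length-⊆ [] f = z≤n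
length-⊆ {xs = x ∷ xs} (x∉ ∷ u) f with ∈-∃++ (f (here refl))
... | ys , zs , refl = begin
  suc (length xs)              ≤⟨ s≤s (length-⊆ u g) ⟩
  suc (length (ys ++ zs))      ≡⟨ cong suc (length-++ ys) ⟩
  suc (length ys + length zs)  ≡⟨ ℕ.+-suc (length ys) (length zs) ⟨
  length ys + suc (length zs)  ≡⟨ length-++ ys ⟨
  length (ys ++ x ∷ zs)        ∎
  where
  open ℕ.≤-Reasoning
  g : ∀ {v} → v ∈ xs → v ∈ ys ++ zs
  g v∈ with ∈-++⁻ ys (f (there v∈))
  ... | inj₁ v∈ys         = ∈-++⁺ˡ v∈ys
  ... | inj₂ (here refl)  = contradiction refl (All.lookup x∉ v∈)
  ... | inj₂ (there v∈zs) = ∈-++⁺ʳ ys v∈zs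

-- The source of the equations in `Card-∖`, `recurrence` and `Perm-length`: one predicate is
-- enumerated in two ways.
Card-unique : Card P k → Card P l → k ≡ l
Card-unique (card _ u s c refl) (card _ u′ s′ c′ refl) =
  ℕ.≤-antisym (length-⊆ u (c′ ∘ s)) (length-⊆ u′ (c ∘ s′))

Card-⇔ : Card P k → (∀ {x} → P x → Q x) → (∀ {x} → Q x → P x) → Card Q k
Card-⇔ (card xs u s c eq) f g = card xs u (f ∘ s) (c ∘ g) eq

Card-≡ : (a : A) → P a → (∀ {x} → P x → x ≡ a) → Card P 1
Card-≡ a pa h = card (a ∷ []) ([] ∷ []) (λ { (here refl) → pa }) (here ∘ h) refl

Card-∅ : (∀ {x} → ¬ P x) → Card P 0
Card-∅ h = card [] [] (λ ()) (⊥-elim ∘ h) refl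

Card-⊎ : Card P k → Card Q l → (∀ {x} → P x → ¬ Q x) → Card (λ x → P x ⊎ Q x) (k + l)
Card-⊎ (card xs u s c refl) (card ys u′ s′ c′ refl) disjoint = card (xs ++ ys)
  (Unique.++⁺ u u′ λ (x∈ , y∈) → disjoint (s x∈) (s′ y∈))
  (λ v∈ → [ inj₁ ∘ s , inj₂ ∘ s′ ]′ (∈-++⁻ xs v∈))
  [ ∈-++⁺ˡ ∘ c , ∈-++⁺ʳ xs ∘ c′ ]′
  (length-++ xs)

length-cartesianProduct : (xs : List A) (ys : List B) →
  length (cartesianProduct xs ys) ≡ length xs ℕ.* length ys
length-cartesianProduct []       ys = refl
length-cartesianProduct (x ∷ xs) ys = trans (length-++ (map (x ,_) ys))
  (cong₂ _+_ (length-map (x ,_) ys) (length-cartesianProduct xs ys))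

Card-× : {P : A → Set} {Q : B → Set} → Card P k → Card Q l → Card (λ (x , y) → P x × Q y) (k ℕ.* l)
Card-× (card xs u s c refl) (card ys u′ s′ c′ refl) = card (cartesianProduct xs ys)
  (Unique.cartesianProduct⁺ u u′)
  (λ v∈ → let x∈ , y∈ = ∈-cartesianProduct⁻ xs ys v∈ in s x∈ , s′ y∈)
  (λ (p , q) → ∈-cartesianProduct⁺ (c p) (c′ q))
  (length-cartesianProduct xs ys)

Unique-map : {xs : List A} (f : A → B) → (∀ {x y} → x ∈ xs → y ∈ xs → f x ≡ f y → x ≡ y) →
  Unique xs → Unique (map f xs)
Unique-map f inj [] = []
Unique-map f inj (x∉ ∷ u) =
  All.map⁺ (All.tabulate λ y∈ eq → All.lookup x∉ y∈ (inj (here refl) (there y∈) eq))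
  ∷ Unique-map f (λ x∈ y∈ → inj (there x∈) (there y∈)) u

Card-image : {P : A → Set} {Q : B → Set} (f : A → B) → Card P k →
  (∀ {x} → P x → Q (f x)) →
  (∀ {x y} → P x → P y → f x ≡ f y → x ≡ y) →
  (∀ {y} → Q y → ∃ λ x → P x × y ≡ f x) →
  Card Q k
Card-image {Q = Q} f (card xs u s c refl) P⇒Q inj surj = card (map f xs)
  (Unique-map f (λ x∈ y∈ → inj (s x∈) (s y∈)) u)
  (λ v∈ → let x , x∈ , eq = ∈-map⁻ f v∈ in subst Q (sym eq) (P⇒Q (s x∈)))
  (λ q → let x , p , eq = surj q in subst (_∈ map f xs) (sym eq) (∈-map⁺ f (c p)))
  (length-map f xs)

-- The counterpart of `Card-image` for a bijection whose target is the side already enumerated: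
-- `lift` chooses preimages along the given list, so no inverse function has to be defined.
Card-preimage : {P : A → Set} {Q : B → Set} (f : A → B) → Card Q k →
  (∀ {x} → P x → Q (f x)) →
  (∀ {x y} → P x → P y → f x ≡ f y → x ≡ y) →
  (∀ {y} → Q y → ∃ λ x → P x × y ≡ f x) →
  Card P k
Card-preimage {P = P} {Q} f (card ys u s c refl) P⇒Q inj surj = card
  preimages (Unique.map⁻ (subst Unique (sym map≡) u)) (all _)
  (λ p → let z , z∈ , eq = ∈-map⁻ f (subst (_ ∈_) (sym map≡) (c (P⇒Q p)))
         in subst (_∈ _) (sym (inj p (all _ z∈) eq)) z∈)
  (trans (sym (length-map f preimages)) (cong length map≡))
  where
  lift : ∀ ys → (∀ {y} → y ∈ ys → Q y) → ∃ λ xs → map f xs ≡ ys × (∀ x → x ∈ xs → P x)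
  lift []       s = [] , refl , λ _ ()
  lift (y ∷ ys) s with surj (s (here refl)) | lift ys (s ∘ there)
  ... | x , p , refl | xs , refl , ps =
    x ∷ xs , refl , λ { _ (here refl) → p ; z (there z∈) → ps z z∈ }
  preimages = proj₁ (lift ys s)
  map≡ = proj₁ (proj₂ (lift ys s))
  all  = proj₂ (proj₂ (lift ys s))

-- Avoids truncated subtraction: the remainder is the length of a filtered list, and the additive
-- equation characterises it.
Card-∖ : {P R : A → Set} → Decidable R → Card P l → Card (λ x → P x × R x) k →
  ∃ λ m → k + m ≡ l × Card (λ x → P x × ¬ R x) m
Card-∖ {P = P} {R} R? cP@(card xs u s c _) cPR = _ , Card-unique
    (Card-⇔ (Card-⊎ cPR rest λ (_ , r) (_ , nr) → nr r) [ proj₁ , proj₁ ]′ (λ p → decide p (R? _)))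
    cP
  , rest
  where
  rest : Card (λ x → P x × ¬ R x) _
  rest = card (filter (¬? ∘ R?) xs) (Unique.filter⁺ (¬? ∘ R?) u)
    (λ v∈ → let x∈ , nr = ∈-filter⁻ (¬? ∘ R?) v∈ in s x∈ , nr)
    (λ (p , nr) → ∈-filter⁺ (¬? ∘ R?) (c p) nr) refl
  decide : ∀ {x} → P x → Dec (R x) → P x × R x ⊎ P x × ¬ R x
  decide p (yes r) = inj₁ (p , r)
  decide p (no nr) = inj₂ (p , nr)

∑ : ℕ → (ℕ → ℕ) → ℕ
∑ zero    f = 0
∑ (suc n) f = f 0 + ∑ n (f ∘ suc)

Card-∑ : ∀ n {P : ℕ → A → Set} (f : ℕ → ℕ) → (∀ i → i < n → Card (P i) (f i)) →
  (∀ {i j x} → P i x → P j x → i ≡ j) → Card (λ x → ∃ λ i → i < n × P i x) (∑ n f)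
Card-∑ zero    f h disjoint = Card-∅ λ { (_ , () , _) }
Card-∑ (suc n) {P} f h disjoint = Card-⇔
  (Card-⊎ (h 0 z<s) (Card-∑ n (f ∘ suc) (λ i i<n → h (suc i) (s<s i<n)) λ p q → ℕ.suc-injective (disjoint p q))
     λ { p (_ , _ , q) → contradiction (disjoint p q) λ () })
  (λ { (inj₁ p) → 0 , z<s , p ; (inj₂ (i , i<n , p)) → suc i , s<s i<n , p })
  (λ { (zero , _ , p) → inj₁ p ; (suc i , i<n , p) → inj₂ (i , s≤s⁻¹ i<n , p) })

-- Sublists and arrangements of intervals

++-⊆⁻ : {zs : List A} (xs : List A) {ys : List A} → zs ⊆ xs ++ ys →
  ∃₂ λ as bs → zs ≡ as ++ bs × as ⊆ xs × bs ⊆ ys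
++-⊆⁻ []       s        = [] , _ , refl , [] , s
++-⊆⁻ (x ∷ xs) (_ ∷ʳ s) with ++-⊆⁻ xs s
... | as , bs , eq , s₁ , s₂ = as , bs , eq , _ ∷ʳ s₁ , s₂
++-⊆⁻ (x ∷ xs) (refl ∷ s) with ++-⊆⁻ xs s
... | as , bs , refl , s₁ , s₂ = x ∷ as , bs , refl , refl ∷ s₁ , s₂

AllPairs-resp-⊆ : {R : A → A → Set} {xs ys : List A} → xs ⊆ ys → AllPairs R ys → AllPairs R xs
AllPairs-resp-⊆ []         []       = []
AllPairs-resp-⊆ (_ ∷ʳ s)   (_ ∷ rs) = AllPairs-resp-⊆ s rs
AllPairs-resp-⊆ (refl ∷ s) (r ∷ rs) = All-resp-⊆ s r ∷ AllPairs-resp-⊆ s rs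

pair-resp-⊆ : {R : A → A → Set} {x y : A} {xs : List A} → AllPairs R xs → x ∷ y ∷ [] ⊆ xs → R x y
pair-resp-⊆ r s with AllPairs-resp-⊆ s r
... | (p ∷ []) ∷ _ = p

-- Places an occurrence in particular blocks. When every block lies on one side of a threshold,
-- filtering by the threshold keeps exactly the blocks of that side.
⊆-filter : {xs ys : List A} (P? : Decidable P) → xs ⊆ ys → All P xs → xs ⊆ filter P? ys
⊆-filter {ys = ys} P? s ps =
  subst (_⊆ filter P? ys) (filter-all P? ps) (filter⁺ P? P? (λ { refl p → p }) s)

partition-++ : {P : A → Set} → Decidable P → (xs : List A) →
  (∀ {b c} → b ∷ c ∷ [] ⊆ xs → ¬ P b → ¬ P c) →
  ∃₂ λ us vs → xs ≡ us ++ vs × All P us × All (¬_ ∘ P) vs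
partition-++ P? [] h = [] , [] , refl , [] , []
partition-++ P? (x ∷ xs) h with P? x
... | no ¬p = [] , x ∷ xs , refl , [] , ¬p ∷ All.tabulate (λ v∈ → h (refl ∷ from∈ v∈) ¬p)
... | yes p with partition-++ P? xs (h ∘ (x ∷ʳ_))
...   | us , vs , refl , ps , ¬ps = x ∷ us , vs , refl , p ∷ ps , ¬ps

-- `Perm a b xs`: xs is an arrangement of the interval [a , b).
record Perm (a b : ℕ) (xs : List ℕ) : Set where
  constructor perm
  field
    bound    : a ≤ b
    unique   : Unique xs
    sound    : ∀ {v} → v ∈ xs → a ≤ v × v < b
    complete : ∀ {v} → a ≤ v → v < b → v ∈ xs
open Perm

Perm-resp-↭ : xs ↭ ys → Perm a b xs → Perm a b ys
Perm-resp-↭ p (perm a≤b u s c) = perm a≤b (↭ₛ.Unique-resp-↭ (↭⇒↭ₛ p) u)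
  (s ∘ ↭.∈-resp-↭ (↭-sym p)) (λ l r → ↭.∈-resp-↭ p (c l r))

Perm-[]⁺ : Perm a a []
Perm-[]⁺ = perm ℕ.≤-refl [] (λ ()) (λ l r → contradiction r (ℕ.≤⇒≯ l))

Perm-[]⁻ : Perm a b [] → b ≡ a
Perm-[]⁻ π with ℕ.m≤n⇒m<n∨m≡n (bound π)
... | inj₂ refl = refl
... | inj₁ a<b with complete π ℕ.≤-refl a<b
...   | ()

Perm-[x]⁺ : Perm x (suc x) [ x ]
Perm-[x]⁺ = perm (ℕ.n≤1+n _) ([] ∷ [])
  (λ { (here refl) → ℕ.≤-refl , ℕ.≤-refl }) (λ l r → here (ℕ.≤-antisym (s≤s⁻¹ r) l))

Perm-[x]⁻ : Perm a b [ x ] → a ≡ x × b ≡ suc x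
Perm-[x]⁻ π with sound π (here refl)
... | a≤x , x<b with complete π ℕ.≤-refl (ℕ.≤-<-trans a≤x x<b)
...   | here refl with ℕ.m≤n⇒m<n∨m≡n x<b
...     | inj₂ refl  = refl , refl
...     | inj₁ 1+x<b with complete π (ℕ.n≤1+n _) 1+x<b
...       | here ()

Perm-++⁺ : Perm a c xs → Perm c b ys → Perm a b (xs ++ ys)
Perm-++⁺ {a} {c} {xs} {b} {ys} π ρ = perm (ℕ.≤-trans (bound π) (bound ρ))
  (Unique.++⁺ (unique π) (unique ρ)
     λ (x∈ , y∈) → ℕ.<⇒≱ (proj₂ (sound π x∈)) (proj₁ (sound ρ y∈)))
  (λ v∈ → [ (λ x∈ → let l , r = sound π x∈ in l , ℕ.<-≤-trans r (bound ρ))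
          , (λ y∈ → let l , r = sound ρ y∈ in ℕ.≤-trans (bound π) l , r) ]′ (∈-++⁻ xs v∈))
  λ l r → [ ∈-++⁺ˡ ∘ complete π l , (λ c≤v → ∈-++⁺ʳ xs (complete ρ c≤v r)) ]′ (ℕ.<-≤-connex _ c)

-- Bounded search with fuel `k`. In `Perm-++⁻` it finds the cut between the two factors; the default
-- `k + a` is then the end of the interval, reached when the right factor is empty.
least : ∀ (ys : List ℕ) k a → ∃ λ c → a ≤ c × c ≤ k + a ×
  (∀ {v} → a ≤ v → v < c → v ∉ ys) × (c ∈ ys ⊎ c ≡ k + a)
least ys zero a = a , ℕ.≤-refl , ℕ.≤-refl , (λ l r → contradiction r (ℕ.≤⇒≯ l)) , inj₂ refl
least ys (suc k) a with a ∈? ys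
... | yes a∈ = a , ℕ.≤-refl , ℕ.m≤n+m a (suc k) , (λ l r → contradiction r (ℕ.≤⇒≯ l)) , inj₁ a∈
... | no  a∉ with least ys k (suc a)
...   | c , a<c , c≤ , below , at rewrite ℕ.+-suc k a =
  c , ℕ.<⇒≤ a<c , c≤ , (λ a≤v v<c → [ (λ a<v → below a<v v<c) , (λ { refl → a∉ }) ]′ (ℕ.m≤n⇒m<n∨m≡n a≤v)) , at

Perm-++⁻ : Perm a b (xs ++ ys) → (∀ {v w} → v ∈ xs → w ∈ ys → v < w) →
  ∃ λ c → Perm a c xs × Perm c b ys
Perm-++⁻ {a} {b} {xs} {ys} π xs<ys with least ys (b ∸ a) a
... | c , a≤c , c≤b , below , at rewrite ℕ.m∸n+n≡m (bound π) =
  c , perm a≤c (AllPairs-resp-⊆ (++⁺ʳ ys ⊆-refl) (unique π))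
        (λ v∈ → proj₁ (sound π (∈-++⁺ˡ v∈)) , xs<c v∈)
        (λ a≤v v<c → [ id , (λ v∈ → contradiction v∈ (below a≤v v<c)) ]′
                      (∈-++⁻ xs (complete π a≤v (ℕ.<-≤-trans v<c c≤b))))
    , perm c≤b (AllPairs-resp-⊆ (++⁺ˡ xs ⊆-refl) (unique π))
        (λ v∈ → c≤ys v∈ , proj₂ (sound π (∈-++⁺ʳ xs v∈)))
        (λ c≤v v<b → [ (λ v∈ → contradiction c≤v (ℕ.<⇒≱ (xs<c v∈))) , id ]′
                      (∈-++⁻ xs (complete π (ℕ.≤-trans a≤c c≤v) v<b)))
  where
  xs<c : ∀ {v} → v ∈ xs → v < c
  xs<c v∈ = [ xs<ys v∈ , (λ c≡b → subst (_ <_) (sym c≡b) (proj₂ (sound π (∈-++⁺ˡ v∈)))) ]′ at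
  c≤ys : ∀ {v} → v ∈ ys → c ≤ v
  c≤ys {v} v∈ = ℕ.≮⇒≥ λ v<c → below (proj₁ (sound π (∈-++⁺ʳ xs v∈))) v<c v∈

Perm-pivot⁺ : Perm a y lo → Perm (suc y) b up → Perm a b (lo ++ y ∷ up)
Perm-pivot⁺ π ρ = Perm-++⁺ π (Perm-++⁺ Perm-[x]⁺ ρ)

Perm-pivot⁻ : Perm a b (lo ++ y ∷ up) → All (_< y) lo → All (y <_) up → Perm a y lo × Perm (suc y) b up
Perm-pivot⁻ π lo< <up with Perm-++⁻ π (λ { v∈ (here refl) → All.lookup lo< v∈
                                         ; v∈ (there w∈)  → ℕ.<-trans (All.lookup lo< v∈) (All.lookup <up w∈) })
... | c , π₁ , ρ with Perm-++⁻ {xs = [ _ ]} ρ (λ { (here refl) w∈ → All.lookup <up w∈ })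
...   | d , ρ₁ , ρ₂ with Perm-[x]⁻ ρ₁
...     | refl , refl = π₁ , ρ₂

decreasing : Unique xs → (∀ {c d} → c ∷ d ∷ [] ⊆ xs → ¬ c < d) → AllPairs (λ v w → w < v) xs
decreasing []       h = []
decreasing (≢s ∷ u) h =
  All.tabulate (λ v∈ → ℕ.≤∧≢⇒< (ℕ.≮⇒≥ (h (refl ∷ from∈ v∈))) (All.lookup ≢s v∈ ∘ sym))
  ∷ decreasing u (λ s → h (_ ∷ʳ s))

-- To recover a maximal prefix of `P`-letters, only the next letter has to fail `P`. Later letters
-- may satisfy it again, as the high letters of `ds` do behind `us ++ p`.
data Stops (P : A → Set) : List A → Set where
  []  : Stops P []
  _∷_ : ∀ {x} → ¬ P x → ∀ xs → Stops P (x ∷ xs)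

stops : {P : A → Set} {xs : List A} → All (¬_ ∘ P) xs → Stops P xs
stops []       = []
stops (¬p ∷ _) = ¬p ∷ _

++-unique : {P : A → Set} {us us′ vs vs′ : List A} → All P us → All P us′ → Stops P vs → Stops P vs′ →
  us ++ vs ≡ us′ ++ vs′ → us ≡ us′ × vs ≡ vs′
++-unique []       []       s        s′       eq   = refl , eq
++-unique []       (p ∷ _)  (¬p ∷ _) s′       refl = contradiction p ¬p
++-unique (p ∷ _)  []       s        (¬p ∷ _) refl = contradiction p ¬p
++-unique (_ ∷ ps) (_ ∷ qs) s        s′       eq with ∷-injective eq
... | refl , eq′ with ++-unique ps qs s s′ eq′
...   | refl , refl = refl , refl

offset : a ≤ b → ∃ λ i → i + a ≡ b
offset a≤b = _ , ℕ.m∸n+n≡m a≤b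

-- Pattern classes

-- In this and the next two types the letters are named by position, and the inequalities run
-- through the values in increasing order.
data Pattern𝕎 : List ℕ → Set where
  p231 : c < a → a < b → Pattern𝕎 (a ∷ b ∷ c ∷ [])
  p213 : b < a → a < c → Pattern𝕎 (a ∷ b ∷ c ∷ [])

data Pattern𝕍 : List ℕ → Set where
  p231  : c < a → a < b → Pattern𝕍 (a ∷ b ∷ c ∷ [])
  p2134 : b < a → a < c → c < d → Pattern𝕍 (a ∷ b ∷ c ∷ d ∷ [])

data Pattern𝕋 : List ℕ → Set where
  p1342 : a < d → d < b → b < c → Pattern𝕋 (a ∷ b ∷ c ∷ d ∷ [])
  p2134 : b < a → a < c → c < d → Pattern𝕋 (a ∷ b ∷ c ∷ d ∷ [])
  p2413 : c < a → a < d → d < b → Pattern𝕋 (a ∷ b ∷ c ∷ d ∷ [])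

Av : (List ℕ → Set) → List ℕ → Set
Av 𝔹 xs = ∀ {zs} → zs ⊆ xs → ¬ 𝔹 zs

Av-⊆ : {𝔹 : List ℕ → Set} → xs ⊆ ys → Av 𝔹 ys → Av 𝔹 xs
Av-⊆ s av t = av (⊆-trans t s)

W V : ℕ → ℕ → List ℕ → Set
W a b xs = Perm a b xs × Av Pattern𝕎 xs
V a b xs = Perm a b xs × Av Pattern𝕍 xs

𝔸 : ℕ → List ℕ → Set
𝔸 n xs = Perm 0 n xs × Av Pattern𝕋 xs

Decreasing : ℕ → ℕ → List ℕ → Set
Decreasing a b xs = Perm a b xs × AllPairs _>_ xs

Perm-max⁺ : Perm a y ys → Perm a (suc y) (y ∷ ys)
Perm-max⁺ {ys = ys} π = Perm-resp-↭ (↭-sym (↭.∷↭∷ʳ _ ys)) (Perm-++⁺ π Perm-[x]⁺)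

Perm-max⁻ : Perm a b (y ∷ ys) → All (_< y) ys → Perm a y ys × b ≡ suc y
Perm-max⁻ {ys = ys} π ys<y =
  let ρ , ε = Perm-pivot⁻ (Perm-resp-↭ (↭.∷↭∷ʳ _ ys) π) ys<y [] in ρ , Perm-[]⁻ ε

Perm-min⁺ : Perm (suc y) b ys → Perm y b (y ∷ ys)
Perm-min⁺ = Perm-pivot⁺ Perm-[]⁺

Perm-a-a : Perm a a xs → xs ≡ []
Perm-a-a {xs = []}    π = refl
Perm-a-a {xs = x ∷ _} π = let l , r = sound π (here refl) in contradiction r (ℕ.≤⇒≯ l)

<All : Perm a b xs → y < a → All (y <_) xs
<All π y<a = All.tabulate λ v∈ → ℕ.<-≤-trans y<a (proj₁ (sound π v∈))

All< : Perm a b xs → b ≤ y → All (_< y) xs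
All< π b≤y = All.tabulate λ v∈ → ℕ.<-≤-trans (proj₂ (sound π v∈)) b≤y

others : All (y ≢_) xs → All (¬_ ∘ (_< y)) xs → All (y <_) xs
others ≢s ≮s = All.zipWith (λ (≢ , ≮) → ℕ.≤∧≢⇒< (ℕ.≮⇒≥ ≮) ≢) (≢s , ≮s)

Perm-cons⁻ : Perm a b (y ∷ ys) → (∀ {c d} → c ∷ d ∷ [] ⊆ ys → y < c → ¬ d < y) →
  ∃₂ λ lo up → ys ≡ lo ++ up × Perm a y lo × Perm (suc y) b up
Perm-cons⁻ {y = y} {ys} π h with unique π
... | y≢ ∷ _ with partition-++ (ℕ._<? y) ys (λ s c≮y d<y →
       h s (ℕ.≤∧≢⇒< (ℕ.≮⇒≥ c≮y) (All.head (All-resp-⊆ s y≢))) d<y)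
...   | lo , up , refl , lo< , up≮ = lo , up , refl ,
  Perm-pivot⁻ (Perm-resp-↭ (↭-sym (↭.shift y lo up)) π) lo< (others (All.++⁻ʳ lo y≢) up≮)

Av-∷⁺ : {𝔹 : List ℕ → Set} → (∀ {zs} → zs ⊆ ys → ¬ 𝔹 (y ∷ zs)) → Av 𝔹 ys → Av 𝔹 (y ∷ ys)
Av-∷⁺ h av (_ ∷ʳ s)   = av s
Av-∷⁺ h av (refl ∷ s) = h s

Av-∷⁻ : {𝔹 : List ℕ → Set} → Av 𝔹 (y ∷ ys) → Av 𝔹 ys
Av-∷⁻ = Av-⊆ (_ ∷ʳ ⊆-refl)

module _ (y<ys : All (y <_) ys) where

  -- Each of 231, 213 and 2134 begins with a letter that is neither its least nor its greatest, so
  -- an extremal first letter starts no occurrence.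
  W-∷-min : Av Pattern𝕎 ys → Av Pattern𝕎 (y ∷ ys)
  W-∷-min = Av-∷⁺ λ where
    s (p231 c<y _) → ℕ.<-asym c<y (All.head (All.tail (All-resp-⊆ s y<ys)))
    s (p213 b<y _) → ℕ.<-asym b<y (All.head (All-resp-⊆ s y<ys))

  V-∷-min : Av Pattern𝕍 ys → Av Pattern𝕍 (y ∷ ys)
  V-∷-min = Av-∷⁺ λ where
    s (p231 c<y _)    → ℕ.<-asym c<y (All.head (All.tail (All-resp-⊆ s y<ys)))
    s (p2134 b<y _ _) → ℕ.<-asym b<y (All.head (All-resp-⊆ s y<ys))

  -- A least first letter can only be the 1 of 1342, and 342 is a 231. Occurrences inside `ys` are
  -- excluded as well: 1342 and 2413 both contain a 231, and 2134 is itself forbidden.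
  T-∷-min : Av Pattern𝕍 ys → Av Pattern𝕋 (y ∷ ys)
  T-∷-min av = Av-∷⁺ {𝔹 = Pattern𝕋} (λ where
      s (p1342 y<d d<b b<c) → av s (p231 d<b b<c)
      s (p2134 b<y _ _)     → ℕ.<-asym b<y (All.head (All-resp-⊆ s y<ys))
      s (p2413 c<y _ _)     → ℕ.<-asym c<y (All.head (All.tail (All-resp-⊆ s y<ys))))
    λ where
      s (p1342 a<d d<b b<c) → av (∷ˡ⁻ s) (p231 d<b b<c)
      s (p2134 b<a a<c c<d) → av s (p2134 b<a a<c c<d)
      s (p2413 c<a a<d d<b) → av (⊆-trans (refl ∷ refl ∷ refl ∷ _ ∷ʳ []) s) (p231 c<a (ℕ.<-trans a<d d<b))

module _ (ys<y : All (_< y) ys) where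

  W-∷-max : Av Pattern𝕎 ys → Av Pattern𝕎 (y ∷ ys)
  W-∷-max = Av-∷⁺ λ where
    s (p231 _ y<b) → ℕ.<-asym y<b (All.head (All-resp-⊆ s ys<y))
    s (p213 _ y<c) → ℕ.<-asym y<c (All.head (All.tail (All-resp-⊆ s ys<y)))

  V-∷-max : Av Pattern𝕍 ys → Av Pattern𝕍 (y ∷ ys)
  V-∷-max = Av-∷⁺ λ where
    s (p231 _ y<b)    → ℕ.<-asym y<b (All.head (All-resp-⊆ s ys<y))
    s (p2134 _ y<c _) → ℕ.<-asym y<c (All.head (All.tail (All-resp-⊆ s ys<y)))

-- A decreasing sequence appended on top of us can supply at most the last letter of a pattern.
V-++⁺ : Av Pattern𝕎 us → AllPairs _>_ ds → (∀ {v w} → v ∈ us → w ∈ ds → v < w) →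
  Av Pattern𝕍 (us ++ ds)
V-++⁺ {us} {ds} av dec us<ds s β with ++-⊆⁻ us s
... | as , bs , refl , s₁ , s₂ = go as s₁ s₂ β
  where
  down : c ∷ d ∷ [] ⊆ ds → ¬ c < d
  down t c<d = ℕ.<-asym c<d (pair-resp-⊆ dec t)
  go : ∀ as {bs} → as ⊆ us → bs ⊆ ds → ¬ Pattern𝕍 (as ++ bs)
  go [] s t (p231 c<a a<b) = down (⊆-trans (refl ∷ refl ∷ _ ∷ʳ []) t) a<b
  go [] s t (p2134 _ _ c<d) = down (∷ˡ⁻ (∷ˡ⁻ t)) c<d
  go (a ∷ []) s t (p231 c<a _) = ℕ.<-asym c<a (us<ds (to∈ s) (to∈ (∷ˡ⁻ t)))
  go (a ∷ []) s t (p2134 _ _ c<d) = down (∷ˡ⁻ t) c<d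
  go (a ∷ b ∷ []) s t (p231 c<a _) = ℕ.<-asym c<a (us<ds (to∈ s) (to∈ t))
  go (a ∷ b ∷ []) s t (p2134 _ _ c<d) = down t c<d
  go (a ∷ b ∷ c ∷ []) s t (p231 c<a a<b) = av s (p231 c<a a<b)
  go (a ∷ b ∷ c ∷ []) s t (p2134 b<a a<c _) = av s (p213 b<a a<c)
  go (a ∷ b ∷ c ∷ d ∷ []) s t (p2134 b<a a<c _) = av (⊆-trans (refl ∷ refl ∷ refl ∷ _ ∷ʳ []) s) (p213 b<a a<c)

-- Each of the three patterns ends above its first letter, so no occurrence starts in `us` and ends
-- in `low`.
T-skew : All (x ≤_) us → All (_< x) low → Av Pattern𝕋 us → Av Pattern𝕋 low → Av Pattern𝕋 (us ++ low)
T-skew {x} {us} {low} x≤us low<x av av′ s β with ++-⊆⁻ us s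
... | as , bs , refl , s₁ , s₂ = go as s₁ s₂ β
  where
  first<last : Pattern𝕋 (a ∷ b ∷ c ∷ d ∷ []) → a < d
  first<last (p1342 a<d _ _)   = a<d
  first<last (p2134 _ a<c c<d) = ℕ.<-trans a<c c<d
  first<last (p2413 _ a<d _)   = a<d
  size4 : Pattern𝕋 zs → ∃₂ λ a b → ∃₂ λ c d → zs ≡ a ∷ b ∷ c ∷ d ∷ []
  size4 (p1342 _ _ _) = _ , _ , _ , _ , refl
  size4 (p2134 _ _ _) = _ , _ , _ , _ , refl
  size4 (p2413 _ _ _) = _ , _ , _ , _ , refl
  cross : a ∷ xs ⊆ us → d ∈ low → ¬ a < d
  cross s d∈ a<d = ℕ.<-irrefl refl
    (ℕ.<-trans (ℕ.≤-<-trans (All.head (All-resp-⊆ s x≤us)) a<d) (All.lookup low<x d∈))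
  go : ∀ as {bs} → as ⊆ us → bs ⊆ low → ¬ Pattern𝕋 (as ++ bs)
  go [] s t β = av′ t β
  go (_ ∷ []) s t β with size4 β
  ... | _ , _ , _ , _ , refl = cross s (to∈ (∷ˡ⁻ (∷ˡ⁻ t))) (first<last β)
  go (_ ∷ _ ∷ []) s t β with size4 β
  ... | _ , _ , _ , _ , refl = cross s (to∈ (∷ˡ⁻ t)) (first<last β)
  go (_ ∷ _ ∷ _ ∷ []) s t β with size4 β
  ... | _ , _ , _ , _ , refl = cross s (to∈ t) (first<last β)
  go (_ ∷ _ ∷ _ ∷ _ ∷ []) s t β with size4 β
  ... | _ , _ , _ , _ , refl = av s β
  go (_ ∷ _ ∷ _ ∷ _ ∷ _ ∷ _) s t β with size4 β
  ... | _ , _ , _ , _ , ()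

-- Cardinalities of the auxiliary classes

uncons : Perm a (suc m + a) xs → ∃₂ λ y ys → xs ≡ y ∷ ys
uncons {xs = []} π = contradiction (sym (Perm-[]⁻ π)) (ℕ.m≢1+n+m _)
uncons {xs = y ∷ ys} π = y , ys , refl

Decreasing-∷⁻ : Decreasing a b (y ∷ ys) → b ≡ suc y × Decreasing a y ys
Decreasing-∷⁻ (π , y>ys ∷ dec) = let ρ , b≡ = Perm-max⁻ π y>ys in b≡ , ρ , dec

Card-Decreasing-+ : ∀ u a → Card (Decreasing a (u + a)) 1
Card-Decreasing-+ zero a = Card-≡ [] (Perm-[]⁺ , []) (λ (π , _) → Perm-a-a π)
Card-Decreasing-+ (suc u) a = Card-image ((u + a) ∷_) (Card-Decreasing-+ u a)
  (λ (π , dec) → Perm-max⁺ π , All< π ℕ.≤-refl ∷ dec)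
  (λ _ _ → proj₂ ∘ ∷-injective)
  surj
  where
  surj : Decreasing a (suc u + a) ys → ∃ λ xs → Decreasing a (u + a) xs × ys ≡ (u + a) ∷ xs
  surj δ with uncons (proj₁ δ)
  ... | y , ys , refl with Decreasing-∷⁻ δ
  ...   | refl , δ′ = ys , δ′ , refl

Card-Decreasing : a ≤ b → Card (Decreasing a b) 1
Card-Decreasing {a} {b} a≤b =
  subst (λ b → Card (Decreasing a b) 1) (ℕ.m∸n+n≡m a≤b) (Card-Decreasing-+ (b ∸ a) a)

W-min : W (suc y) b ys → W y b (y ∷ ys)
W-min (π , av) = Perm-min⁺ π , W-∷-min (<All π ℕ.≤-refl) av

W-max : W a y ys → W a (suc y) (y ∷ ys)
W-max (π , av) = Perm-max⁺ π , W-∷-max (All< π ℕ.≤-refl) av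

-- A letter below and a letter above the first one would form 231 or 213 with it, so the first
-- letter is extremal. This choice at every letter but the last gives the power of two in `countW`.
W-∷⁻ : W a b (y ∷ ys) → y ≡ a × W (suc a) b ys ⊎ b ≡ suc y × W a y ys
W-∷⁻ (π , av) with Perm-cons⁻ π (λ s y<c d<y → av (refl ∷ s) (p231 d<y y<c))
... | []     , up     , refl , ρ , σ with Perm-[]⁻ ρ
...   | refl = inj₁ (refl , σ , Av-∷⁻ av)
W-∷⁻ {a} {y = y} (π , av) | l ∷ lo , []     , refl , ρ , σ =
  inj₂ (Perm-[]⁻ σ , subst (W a y) (sym (++-identityʳ _)) (ρ , Av-⊆ (y ∷ʳ ++⁺ʳ [] ⊆-refl) av))
W-∷⁻ (π , av) | l ∷ lo , u ∷ up , refl , ρ , σ = ⊥-elim (av (refl ∷ refl ∷ ++⁺ˡ lo (refl ∷ minimum up))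
  (p213 (proj₂ (sound ρ (here refl))) (proj₁ (sound σ (here refl)))))

countW : ℕ → ℕ
countW zero    = 1
countW (suc m) = 2 ^ m

Card-W-+ : ∀ u a → Card (W a (u + a)) (countW u)
Card-W-+ zero a = Card-≡ [] (Perm-[]⁺ , λ { [] () }) (λ (π , _) → Perm-a-a π)
-- For a single letter, least and greatest coincide; the two alternatives are disjoint only from
-- length two on.
Card-W-+ (suc zero) a = Card-≡ [ a ] (W-min (Perm-[]⁺ , λ { [] () })) only
  where
  only : W a (suc a) xs → xs ≡ [ a ]
  only ω with uncons {m = 0} (proj₁ ω)
  ... | y , ys , refl with W-∷⁻ ω
  ...   | inj₁ (refl , π , _) = cong (y ∷_) (Perm-a-a π)
  ...   | inj₂ (refl , π , _) = cong (y ∷_) (Perm-a-a π)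
Card-W-+ (suc (suc m)) a = subst (Card _) (cong (2 ^ m ℕ.+_) (sym (ℕ.+-identityʳ (2 ^ m)))) (Card-⇔
  (Card-⊎
    (Card-image {Q = λ xs → ∃ λ ys → W (suc a) (suc (suc m) + a) ys × xs ≡ a ∷ ys} (a ∷_)
      (subst (λ b → Card (W (suc a) b) (2 ^ m)) (cong suc (ℕ.+-suc m a)) (Card-W-+ (suc m) (suc a)))
      (λ ω → _ , ω , refl) (λ _ _ → proj₂ ∘ ∷-injective) id)
    (Card-image {Q = λ xs → ∃ λ ys → W a (suc m + a) ys × xs ≡ (suc m + a) ∷ ys} ((suc m + a) ∷_)
      (Card-W-+ (suc m) a)
      (λ ω → _ , ω , refl) (λ _ _ → proj₂ ∘ ∷-injective) id)
    λ { (_ , _ , refl) (_ , _ , eq) → ℕ.m≢1+n+m a (proj₁ (∷-injective eq)) })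
  (λ { (inj₁ (_ , ω , refl)) → W-min ω ; (inj₂ (_ , ω , refl)) → W-max ω })
  cover)
  where
  cover : W a (suc (suc m) + a) xs →
    (∃ λ ys → W (suc a) (suc (suc m) + a) ys × xs ≡ a ∷ ys) ⊎
    (∃ λ ys → W a (suc m + a) ys × xs ≡ (suc m + a) ∷ ys)
  cover ω with uncons (proj₁ ω)
  ... | y , ys , refl with W-∷⁻ ω
  ...   | inj₁ (refl , ω′) = inj₁ (_ , ω′ , refl)
  ...   | inj₂ (refl , ω′) = inj₂ (_ , ω′ , refl)

V-min : V (suc y) b ys → V y b (y ∷ ys)
V-min (π , av) = Perm-min⁺ π , V-∷-min (<All π ℕ.≤-refl) av

V-max : V a y ys → V a (suc y) (y ∷ ys)
V-max (π , av) = Perm-max⁺ π , V-∷-max (All< π ℕ.≤-refl) av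

V-mid : W a y lo → Decreasing (suc y) b up → V a b (y ∷ lo ++ up)
V-mid {y = y} {lo = lo} {up = up} (π , av) (ρ , dec) =
  Perm-resp-↭ (↭.shift y lo up) (Perm-pivot⁺ π ρ) ,
  Av-∷⁺ h (V-++⁺ av dec λ v∈ w∈ → ℕ.<-trans (proj₂ (sound π v∈)) (proj₁ (sound ρ w∈)))
  where
  lo<y = All< π ℕ.≤-refl
  y<up = <All ρ ℕ.≤-refl
  high : zs ⊆ lo ++ up → All (y <_) zs → zs ⊆ up
  high s y< = subst (_ ⊆_) (trans (filter-++ (y ℕ.<?_) lo up)
    (cong₂ _++_ (filter-none (y ℕ.<?_) (All.map ℕ.<-asym lo<y)) (filter-all (y ℕ.<?_) y<up)))
    (⊆-filter (y ℕ.<?_) s y<)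
  h : zs ⊆ lo ++ up → ¬ Pattern𝕍 (y ∷ zs)
  h s (p231 c<y y<b) with ++-⊆⁻ lo s
  ... | [] , _ , refl , _ , t = ℕ.<-asym c<y (All.head (All.tail (All-resp-⊆ t y<up)))
  ... | _ ∷ _ , _ , eq , t , _ with ∷-injective eq
  ...   | refl , _ = ℕ.<-asym y<b (All.head (All-resp-⊆ t lo<y))
  h s (p2134 _ y<c c<d) = ℕ.<-asym c<d
    (pair-resp-⊆ dec (high (∷ˡ⁻ s) (y<c ∷ ℕ.<-trans y<c c<d ∷ [])))

data VCase (a b y : ℕ) : List ℕ → Set where
  min : y ≡ a → V (suc a) b ys → VCase a b y ys
  max : b ≡ suc y → V a y ys → VCase a b y ys
  mid : W a y lo → Decreasing (suc y) b up → a < y → suc y < b → VCase a b y (lo ++ up)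

-- Avoiding 231 puts the letters below `y` before those above it. If both kinds occur, an upper
-- letter would complete a 213 of the lower block to 2134, and an ascent of the upper block would
-- complete `y` and a lower letter to 2134.
V-∷⁻ : V a b (y ∷ ys) → VCase a b y ys
V-∷⁻ (π , av) with Perm-cons⁻ π (λ s y<c d<y → av (refl ∷ s) (p231 d<y y<c))
... | []     , up     , refl , ρ , σ with Perm-[]⁻ ρ
...   | refl = min refl (σ , Av-∷⁻ av)
V-∷⁻ {a} {y = y} (π , av) | l ∷ lo , []     , refl , ρ , σ =
  max (Perm-[]⁻ σ) (subst (V a y) (sym (++-identityʳ _)) (ρ , Av-⊆ (y ∷ʳ ++⁺ʳ [] ⊆-refl) av))
V-∷⁻ {a} {b} {y} (π , av) | lo@(l ∷ lo′) , up@(u ∷ up′) , refl , ρ , σ = mid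
  (ρ , λ { s (p231 c<a a<b) → av (y ∷ʳ ++⁺ʳ up s) (p231 c<a a<b)
         ; s (p213 b<a a<c) → av (y ∷ʳ ++⁺ s (refl ∷ minimum up′))
             (p2134 b<a a<c (ℕ.<-trans (All.lookup (All< ρ ℕ.≤-refl) (to∈ (∷ˡ⁻ (∷ˡ⁻ s)))) y<u)) })
  (σ , decreasing (unique σ) λ s c<d → av (refl ∷ refl ∷ ++⁺ˡ lo′ s)
     (p2134 l<y (All.lookup (<All σ ℕ.≤-refl) (to∈ (⊆-trans (refl ∷ minimum _) s))) c<d))
  (ℕ.≤-<-trans (proj₁ (sound ρ (here refl))) l<y)
  (ℕ.≤-<-trans y<u (proj₂ (sound σ (here refl))))
  where
  l<y = proj₂ (sound ρ (here refl))
  y<u = proj₁ (sound σ (here refl))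

-- The first letter is least, or greatest, or has `i + 1` letters below it and at least one above.
-- In the last case the lower letters form one of `2 ^ i` words of `W`, and the upper letters can
-- only decrease.
countV : ℕ → ℕ
countV zero          = 1
countV (suc zero)    = 1
countV (suc (suc m)) = countV (suc m) + (countV (suc m) + ∑ m (2 ^_))

Mid : ℕ → ℕ → ℕ → List ℕ → Set
Mid a b y xs = ∃ λ ((lo , up) : List ℕ × List ℕ) → (W a y lo × Decreasing (suc y) b up) × xs ≡ y ∷ lo ++ up

Card-Mid : ∀ i a → suc (suc i + a) ≤ b → Card (Mid a b (suc i + a)) (2 ^ i)
Card-Mid i a y<b = subst (Card _) (ℕ.*-identityʳ (2 ^ i)) (Card-image (λ (lo , up) → (suc i + a) ∷ lo ++ up)
  (Card-× (Card-W-+ (suc i) a) (Card-Decreasing y<b))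
  (λ p → _ , p , refl)
  (λ ((π , _) , (ρ , _)) ((π′ , _) , (ρ′ , _)) eq →
    let eq₁ , eq₂ = ++-unique (All< π ℕ.≤-refl) (All< π′ ℕ.≤-refl) (above ρ) (above ρ′) (proj₂ (∷-injective eq))
    in cong₂ _,_ eq₁ eq₂)
  id)
  where
  above : ∀ {y b xs} → Perm (suc y) b xs → Stops (_< y) xs
  above ρ = stops (All.map ℕ.<-asym (<All ρ ℕ.≤-refl))

Card-V-+ : ∀ u a → Card (V a (u + a)) (countV u)
Card-V-+ zero a = Card-≡ [] (Perm-[]⁺ , λ { [] () }) (λ (π , _) → Perm-a-a π)
Card-V-+ (suc zero) a = Card-≡ [ a ] (V-min (Perm-[]⁺ , λ { [] () })) only
  where
  only : V a (suc a) xs → xs ≡ [ a ]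
  only ω with uncons {m = 0} (proj₁ ω)
  ... | y , ys , refl with V-∷⁻ ω
  ...   | min refl (π , _)    = cong (y ∷_) (Perm-a-a π)
  ...   | max refl (π , _)    = cong (y ∷_) (Perm-a-a π)
  ...   | mid _ _ a<y 1+y<1+a = contradiction (s≤s⁻¹ 1+y<1+a) (ℕ.<⇒≯ a<y)
Card-V-+ (suc (suc m)) a = Card-⇔
  (Card-⊎
    (Card-image {Q = λ xs → ∃ λ ys → V (suc a) (suc (suc m) + a) ys × xs ≡ a ∷ ys} (a ∷_)
      (subst (λ b → Card (V (suc a) b) (countV (suc m))) (cong suc (ℕ.+-suc m a)) (Card-V-+ (suc m) (suc a)))
      (λ ω → _ , ω , refl) (λ _ _ → proj₂ ∘ ∷-injective) id)
    (Card-⊎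
      (Card-image {Q = λ xs → ∃ λ ys → V a (suc m + a) ys × xs ≡ (suc m + a) ∷ ys} ((suc m + a) ∷_)
        (Card-V-+ (suc m) a)
        (λ ω → _ , ω , refl) (λ _ _ → proj₂ ∘ ∷-injective) id)
      (Card-∑ m {λ i → Mid a (suc (suc m) + a) (suc i + a)} (2 ^_) (λ i i<m → Card-Mid i a (s≤s (ℕ.+-monoˡ-≤ a (s≤s (ℕ.<⇒≤ i<m)))))
        λ { (_ , _ , refl) (_ , _ , eq) → ℕ.+-cancelʳ-≡ a _ _ (ℕ.suc-injective (proj₁ (∷-injective eq))) })
      λ { (_ , _ , refl) (i , i<m , _ , _ , eq) → ℕ.<⇒≢ i<m (sym (ℕ.+-cancelʳ-≡ a _ _ (ℕ.suc-injective (proj₁ (∷-injective eq))))) })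
    λ { (_ , _ , refl) (inj₁ (_ , _ , eq)) → ℕ.m≢1+n+m a (proj₁ (∷-injective eq))
      ; (_ , _ , refl) (inj₂ (i , _ , _ , _ , eq)) → ℕ.m≢1+n+m a {i} (proj₁ (∷-injective eq)) })
  (λ { (inj₁ (_ , ω , refl)) → V-min ω
     ; (inj₂ (inj₁ (_ , ω , refl))) → V-max ω
     ; (inj₂ (inj₂ (_ , _ , _ , (ω , δ) , refl))) → V-mid ω δ })
  cover
  where
  cover : V a (suc (suc m) + a) xs →
    (∃ λ ys → V (suc a) (suc (suc m) + a) ys × xs ≡ a ∷ ys) ⊎
    (∃ λ ys → V a (suc m + a) ys × xs ≡ (suc m + a) ∷ ys) ⊎
    (∃ λ i → i < m × Mid a (suc (suc m) + a) (suc i + a) xs)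
  cover ω with uncons (proj₁ ω)
  ... | y , ys , refl with V-∷⁻ ω
  ...   | min refl ω′ = inj₁ (_ , ω′ , refl)
  ...   | max refl ω′ = inj₂ (inj₁ (_ , ω′ , refl))
  ...   | mid ω′ δ a<y 1+y<b with offset a<y
  ...     | i , refl rewrite ℕ.+-suc i a =
    inj₂ (inj₂ (i , ℕ.+-cancelʳ-< a i m (s≤s⁻¹ (s≤s⁻¹ 1+y<b)) , _ , (ω′ , δ) , refl))

Card-V : a ≤ b → Card (V a b) (countV (b ∸ a))
Card-V {a} {b} a≤b = subst (λ b′ → Card (V a b′) (countV (b ∸ a))) (ℕ.m∸n+n≡m a≤b) (Card-V-+ (b ∸ a) a)

-- The cut `c` separates the values of `us` from those of `ds`. Strictness of `c < b` makes `ds`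
-- nonempty, which keeps this case apart from the skew one.
Pairs : ℕ → ℕ → List ℕ × List ℕ → Set
Pairs a b (us , ds) = ∃ λ c → c < b × W a c us × Decreasing c b ds

Card-Pairs-+ : ∀ u a → Card (Pairs a (u + a)) (∑ u countW)
Card-Pairs-+ u a = Card-⇔
  (Card-∑ u {λ i (us , ds) → W a (i + a) us × Decreasing (i + a) (u + a) ds} countW
    (λ i i<u → subst (Card _) (ℕ.*-identityʳ (countW i))
      (Card-× (Card-W-+ i a) (Card-Decreasing (ℕ.+-monoˡ-≤ a (ℕ.<⇒≤ i<u)))))
    λ (ω , _) (ω′ , _) → ℕ.+-cancelʳ-≡ a _ _ (Perm-end (proj₁ ω) (proj₁ ω′)))
  (λ (i , i<u , ω , δ) → i + a , ℕ.+-monoˡ-< a i<u , ω , δ)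
  λ { (c , c<b , ω , δ) → case offset (bound (proj₁ ω)) of λ
      { (i , refl) → i , ℕ.+-cancelʳ-< a i u c<b , ω , δ } }
  where
  end≤ : ∀ {a b c xs} → Perm a b xs → Perm a c xs → b ≤ c
  end≤ π ρ = ℕ.≮⇒≥ λ c<b → ℕ.<-irrefl refl (proj₂ (sound ρ (complete π (bound ρ) c<b)))
  Perm-end : ∀ {a b c xs} → Perm a b xs → Perm a c xs → b ≡ c
  Perm-end π ρ = ℕ.≤-antisym (end≤ π ρ) (end≤ ρ π)

Card-Pairs : a ≤ b → Card (Pairs a b) (∑ (b ∸ a) countW)
Card-Pairs {a} {b} a≤b = subst (λ b′ → Card (Pairs a b′) (∑ (b ∸ a) countW)) (ℕ.m∸n+n≡m a≤b) (Card-Pairs-+ (b ∸ a) a)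

-- Decomposition by the first letter

module Inflate {x us p ds q}
  (p<x : All (_< x) p) (x<ds : All (x <_) ds) (q<x : All (_< x) q) (x<us : All (x <_) us)
  (dec : AllPairs _>_ ds) (us<ds : ∀ {v w} → v ∈ us → w ∈ ds → v < w)
  (avM : Av Pattern𝕋 (p ++ x ∷ q)) (avus : Av Pattern𝕎 us) where

  rest : List ℕ
  rest = p ++ ds ++ q

  high : zs ⊆ rest → All (x <_) zs → zs ⊆ ds
  high s x< = subst (_ ⊆_)
    (trans (filter-++ (x ℕ.<?_) p (ds ++ q))
      (trans (cong₂ _++_ (filter-none (x ℕ.<?_) (All.map ℕ.<-asym p<x)) (filter-++ (x ℕ.<?_) ds q))
        (trans (cong₂ _++_ (filter-all (x ℕ.<?_) x<ds) (filter-none (x ℕ.<?_) (All.map ℕ.<-asym q<x)))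
          (++-identityʳ ds))))
    (⊆-filter (x ℕ.<?_) s x<)

  low⊆ : zs ⊆ rest → All (_< x) zs → zs ⊆ p ++ q
  low⊆ s <x = subst (_ ⊆_)
    (trans (filter-++ (ℕ._<? x) p (ds ++ q))
      (cong₂ _++_ (filter-all (ℕ._<? x) p<x)
        (trans (filter-++ (ℕ._<? x) ds q)
          (cong₂ _++_ (filter-none (ℕ._<? x) (All.map ℕ.<-asym x<ds)) (filter-all (ℕ._<? x) q<x)))))
    (⊆-filter (ℕ._<? x) s <x)

  descent : c ∷ d ∷ [] ⊆ rest → x < c → x < d → d < c
  descent s x<c x<d = pair-resp-⊆ dec (high s (x<c ∷ x<d ∷ []))

  contiguous : b ∷ c ∷ d ∷ [] ⊆ rest → x < b → c < x → ¬ x < d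
  contiguous s x<b c<x x<d with ++-⊆⁻ p s
  ... | _ ∷ _ , _ , eq , s₁ , _ with ∷-injective eq
  ...   | refl , _ = ℕ.<-asym x<b (All.head (All-resp-⊆ s₁ p<x))
  contiguous s x<b c<x x<d | [] , _ , refl , _ , s₂ with ++-⊆⁻ ds s₂
  ... | [] , _ , refl , _ , t₂ = ℕ.<-asym x<b (All.head (All-resp-⊆ t₂ q<x))
  ... | _ ∷ [] , _ , refl , _ , t₂ = ℕ.<-asym x<d (All.lookup q<x (to∈ (∷ˡ⁻ t₂)))
  ... | _ ∷ _ ∷ _ , _ , eq , t₁ , _ with ∷-injective eq
  ...   | refl , eq′ with ∷-injective eq′
  ...     | refl , _ = ℕ.<-asym c<x (All.head (All.tail (All-resp-⊆ t₁ x<ds)))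

  collapse-ds : ∀ ds′ {l} → All (x <_) ds′ → x < f → All (_< x) l → f ∷ l ⊆ ds′ ++ q → l ⊆ q
  collapse-ds [] _ x<f _ s = contradiction x<f (ℕ.<-asym (All.head (All-resp-⊆ s q<x)))
  collapse-ds (_ ∷ ds′) (_ ∷ x<ds′) x<f l<x (_ ∷ʳ s) = collapse-ds ds′ x<ds′ x<f l<x s
  collapse-ds (_ ∷ ds′) (_ ∷ x<ds′) x<f l<x (refl ∷ s) = subst (_ ⊆_)
    (trans (filter-++ (ℕ._<? x) ds′ q)
       (cong₂ _++_ (filter-none (ℕ._<? x) (All.map ℕ.<-asym x<ds′)) (filter-all (ℕ._<? x) q<x)))
    (⊆-filter (ℕ._<? x) s l<x)

  ascent : {Z : Set} → b ∷ c ∷ [] ⊆ ds ++ q → b < x → x < c → Z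
  ascent s b<x x<c with ++-⊆⁻ ds s
  ... | [] , _ , refl , _ , t = contradiction x<c (ℕ.<-asym (All.lookup q<x (to∈ (∷ˡ⁻ t))))
  ... | _ ∷ _ , _ , eq , t , _ with ∷-injective eq
  ...   | refl , _ = contradiction b<x (ℕ.<-asym (All.head (All-resp-⊆ t x<ds)))

  -- Here `f` is the only high letter of an occurrence, between low parts `k` and `l`. It has to
  -- come from `ds`, which forces `k` into `p′` and `l` into `q`, so `x` can take its place.
  -- Recursion runs over suffixes `p′` of `p`.
  collapse : ∀ p′ k {l} → All (_< x) p′ → All (_< x) k → x < f → All (_< x) l →
    k ++ f ∷ l ⊆ p′ ++ ds ++ q → k ++ x ∷ l ⊆ p′ ++ x ∷ q
  collapse [] [] _ _ x<f l<x s = refl ∷ collapse-ds ds x<ds x<f l<x s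
  collapse [] (v ∷ k) _ (v<x ∷ k<x) x<f l<x s = ascent (⊆-trans (refl ∷ ++⁺ˡ k (refl ∷ minimum _)) s) v<x x<f
  collapse (_ ∷ p′) [] (_ ∷ p<) k<x x<f l<x (_ ∷ʳ s) = _ ∷ʳ collapse p′ [] p< k<x x<f l<x s
  collapse (_ ∷ p′) k@(_ ∷ _) (_ ∷ p<) k<x x<f l<x (_ ∷ʳ s) = _ ∷ʳ collapse p′ k p< k<x x<f l<x s
  collapse (_ ∷ p′) [] (f<x ∷ _) k<x x<f l<x (refl ∷ s) = contradiction x<f (ℕ.<-asym f<x)
  collapse (_ ∷ p′) (_ ∷ k) (_ ∷ p<) (_ ∷ k<x) x<f l<x (refl ∷ s) = refl ∷ collapse p′ k p< k<x x<f l<x s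

  dichotomy : All (λ v → v < x ⊎ x < v) rest
  dichotomy = All.++⁺ (All.map inj₁ p<x) (All.++⁺ (All.map inj₂ x<ds) (All.map inj₁ q<x))

  side : c ∷ zs ⊆ rest → c < x ⊎ x < c
  side s = All.head (All-resp-⊆ s dichotomy)

  only-low : zs ⊆ rest → All (_< x) zs → Av Pattern𝕋 zs
  only-low s <x = Av-⊆ (⊆-trans (low⊆ s <x) (++⁺ ⊆-refl (x ∷ʳ ⊆-refl))) avM

  -- If any letter of an occurrence is high, its largest is. A second high letter would give an
  -- ascent inside the decreasing block `ds` or, for 2413 with a low 1, a gap in that block. So only
  -- the largest letter is high, and lowering it to `x` yields an occurrence in `p ++ x ∷ q`.
  avrest : Av Pattern𝕋 rest
  avrest s β@(p1342 a<d d<b b<c) with side (∷ˡ⁻ (∷ˡ⁻ s)) | side (∷ˡ⁻ s)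
  ... | inj₁ c<x | _ = only-low s (<x (ℕ.<-trans a<d (ℕ.<-trans d<b b<c)) ∷ <x b<c ∷ c<x ∷ <x (ℕ.<-trans d<b b<c) ∷ []) ⊆-refl β
    where <x = λ {v} (v<c : v < _) → ℕ.<-trans v<c c<x
  ... | inj₂ x<c | inj₂ x<b = ℕ.<-asym b<c (descent (⊆-trans (refl ∷ refl ∷ _ ∷ʳ []) (∷ˡ⁻ s)) x<b x<c)
  ... | inj₂ x<c | inj₁ b<x = avM
    (collapse p (_ ∷ _ ∷ []) p<x (ℕ.<-trans a<d (ℕ.<-trans d<b b<x) ∷ b<x ∷ []) x<c (ℕ.<-trans d<b b<x ∷ []) s)
    (p1342 a<d d<b b<x)
  avrest s β@(p2134 b<a a<c c<d) with side (∷ˡ⁻ (∷ˡ⁻ (∷ˡ⁻ s))) | side (∷ˡ⁻ (∷ˡ⁻ s))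
  ... | inj₁ d<x | _ = only-low s (<x (ℕ.<-trans a<c c<d) ∷ <x (ℕ.<-trans b<a (ℕ.<-trans a<c c<d)) ∷ <x c<d ∷ d<x ∷ []) ⊆-refl β
    where <x = λ {v} (v<d : v < _) → ℕ.<-trans v<d d<x
  ... | inj₂ x<d | inj₂ x<c = ℕ.<-asym c<d (descent (∷ˡ⁻ (∷ˡ⁻ s)) x<c x<d)
  ... | inj₂ x<d | inj₁ c<x = avM
    (collapse p (_ ∷ _ ∷ _ ∷ []) p<x (ℕ.<-trans a<c c<x ∷ ℕ.<-trans b<a (ℕ.<-trans a<c c<x) ∷ c<x ∷ []) x<d [] s)
    (p2134 b<a a<c c<x)
  avrest s β@(p2413 c<a a<d d<b) with side (∷ˡ⁻ s) | side (∷ˡ⁻ (∷ˡ⁻ (∷ˡ⁻ s))) | side (∷ˡ⁻ (∷ˡ⁻ s))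
  ... | inj₁ b<x | _ | _ = only-low s (<x (ℕ.<-trans a<d d<b) ∷ b<x ∷ <x (ℕ.<-trans c<a (ℕ.<-trans a<d d<b)) ∷ <x d<b ∷ []) ⊆-refl β
    where <x = λ {v} (v<b : v < _) → ℕ.<-trans v<b b<x
  ... | inj₂ x<b | inj₂ x<d | inj₁ c<x = contiguous (∷ˡ⁻ s) x<b c<x x<d
  ... | inj₂ x<b | inj₂ x<d | inj₂ x<c = ℕ.<-asym (ℕ.<-trans c<a a<d) (descent (∷ˡ⁻ (∷ˡ⁻ s)) x<c x<d)
  ... | inj₂ x<b | inj₁ d<x | _ = avM
    (collapse p (_ ∷ []) p<x (ℕ.<-trans a<d d<x ∷ []) x<b (ℕ.<-trans (ℕ.<-trans c<a a<d) d<x ∷ d<x ∷ []) s)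
    (p2413 c<a a<d d<x)

  top : List ℕ
  top = x ∷ us

  x≤top : All (x ≤_) top
  x≤top = ℕ.≤-refl ∷ All.map ℕ.<⇒≤ x<us

  below : a < x → a ∷ zs ⊆ top ++ rest → a ∷ zs ⊆ rest
  below a<x s with ++-⊆⁻ top s
  ... | [] , _ , refl , _ , t = t
  ... | _ ∷ _ , _ , eq , t , _ with ∷-injective eq
  ...   | refl , _ = contradiction a<x (ℕ.≤⇒≯ (All.head (All-resp-⊆ t x≤top)))

  upper : zs ⊆ top ++ rest → All (x ≤_) zs → zs ⊆ top ++ ds
  upper s x≤ = subst (_ ⊆_)
    (trans (filter-++ (x ℕ.≤?_) top rest)
      (cong₂ _++_ (filter-all (x ℕ.≤?_) x≤top)
        (trans (filter-++ (x ℕ.≤?_) p (ds ++ q))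
          (trans (cong₂ _++_ (filter-none (x ℕ.≤?_) (All.map ℕ.<⇒≱ p<x)) (filter-++ (x ℕ.≤?_) ds q))
            (trans (cong₂ _++_ (filter-all (x ℕ.≤?_) (All.map ℕ.<⇒≤ x<ds)) (filter-none (x ℕ.≤?_) (All.map ℕ.<⇒≱ q<x)))
              (++-identityʳ ds))))))
    (⊆-filter (x ℕ.≤?_) s x≤)

  avtop : Av Pattern𝕋 (top ++ ds)
  avtop = T-∷-min (All.++⁺ x<us x<ds) (V-++⁺ avus dec us<ds)

  top<ds : ∀ {v w} → v ∈ top → w ∈ ds → v < w
  top<ds (here refl) w∈ = All.lookup x<ds w∈
  top<ds (there v∈)  w∈ = us<ds v∈ w∈

  -- An occurrence that starts below `x` lies in `rest`, and one without letters below `x` lies in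
  -- `top ++ ds`. The mixed cases are 2134 and 2413 with only the 1 below `x`: the first needs an
  -- ascent in `ds`, the second a gap in `ds` or a letter of `top` exceeding one of `ds`.
  av : Av Pattern𝕋 (top ++ rest)
  av {a ∷ b ∷ c ∷ d ∷ []} s β@(p1342 a<d d<b b<c) with ℕ.<-≤-connex a x
  ... | inj₁ a<x = avrest (below a<x s) β
  ... | inj₂ x≤a = avtop (upper s (x≤a ∷ x≤ (ℕ.<-trans a<d d<b) ∷ x≤ (ℕ.<-trans a<d (ℕ.<-trans d<b b<c)) ∷ x≤ a<d ∷ [])) β
    where x≤ = λ {v} (a<v : a < v) → ℕ.≤-trans x≤a (ℕ.<⇒≤ a<v)
  av {a ∷ b ∷ c ∷ d ∷ []} s β@(p2134 b<a a<c c<d) with ℕ.<-≤-connex a x | ℕ.<-≤-connex b x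
  ... | inj₁ a<x | _        = avrest (below a<x s) β
  ... | inj₂ x≤a | inj₁ b<x = ℕ.<-asym c<d (descent (∷ˡ⁻ (below b<x (∷ˡ⁻ s))) (ℕ.≤-<-trans x≤a a<c) (ℕ.≤-<-trans x≤a (ℕ.<-trans a<c c<d)))
  ... | inj₂ x≤a | inj₂ x≤b = avtop (upper s (x≤a ∷ x≤b ∷ x≤ a<c ∷ x≤ (ℕ.<-trans a<c c<d) ∷ [])) β
    where x≤ = λ {v} (a<v : a < v) → ℕ.≤-trans x≤a (ℕ.<⇒≤ a<v)
  av {a ∷ b ∷ c ∷ d ∷ []} s β@(p2413 c<a a<d d<b) with ℕ.<-≤-connex a x | ℕ.<-≤-connex c x
  ... | inj₁ a<x | _        = avrest (below a<x s) β
  ... | inj₂ x≤a | inj₂ x≤c = avtop (upper s (x≤a ∷ x≤ (ℕ.<-trans a<d d<b) ∷ x≤c ∷ x≤ a<d ∷ [])) β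
    where x≤ = λ {v} (a<v : a < v) → ℕ.≤-trans x≤a (ℕ.<⇒≤ a<v)
  ... | inj₂ x≤a | inj₁ c<x with below c<x (∷ˡ⁻ (∷ˡ⁻ s)) | ++-⊆⁻ top (∷ˡ⁻ s)
  ...   | _ | [] , _ , refl , _ , t = contiguous t (ℕ.<-trans x<d d<b) c<x x<d
    where x<d = ℕ.≤-<-trans x≤a a<d
  ...   | t | _ ∷ _ , _ , eq , t₁ , _ with ∷-injective eq
  ...     | refl , _ = ℕ.<-asym d<b (top<ds (to∈ (⊆-trans (refl ∷ minimum _) t₁)) (to∈ (high (∷ˡ⁻ t) (ℕ.≤-<-trans x≤a a<d ∷ []))))

data Shape (x : ℕ) : List ℕ → Set where
  skew     : All (x <_) us → All (_< x) low → Shape x (us ++ low)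
  inflated : All (x <_) us → All (_< x) (b ∷ p) → All (x <_) (d ∷ ds) → All (_< x) q →
             Shape x (us ++ (b ∷ p) ++ (d ∷ ds) ++ q)

blocks : All (x ≢_) xs → (∀ {b c d} → b ∷ c ∷ d ∷ [] ⊆ xs → x < b → c < x → ¬ x < d) →
  ∃₂ λ p ds → ∃ λ q → xs ≡ p ++ ds ++ q × All (_< x) p × All (x <_) ds × All (_< x) q
blocks {xs = []} [] h = [] , [] , [] , refl , [] , [] , []
blocks {x} {y ∷ ys} (x≢y ∷ x≢ys) h with ℕ.<-cmp x y
... | tri≈ _ x≡y _ = contradiction x≡y x≢y
... | tri> _ _ y<x with blocks x≢ys (h ∘ (y ∷ʳ_))
...   | p , ds , q , refl , p< , <ds , q< = y ∷ p , ds , q , refl , y<x ∷ p< , <ds , q<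
blocks {x} {y ∷ ys} (x≢y ∷ x≢ys) h | tri< x<y _ _
  with partition-++ (x ℕ.<?_) ys (λ s x≮c x<d →
         h (refl ∷ s) x<y (ℕ.≤∧≢⇒< (ℕ.≮⇒≥ x≮c) (All.head (All-resp-⊆ s x≢ys) ∘ sym)) x<d)
... | ds , q , refl , <ds , ≮q = [] , y ∷ ds , q , refl , [] , x<y ∷ <ds ,
  All.zipWith (λ (≢ , ≮) → ℕ.≤∧≢⇒< (ℕ.≮⇒≥ ≮) (≢ ∘ sym)) (All.++⁻ʳ ds x≢ys , ≮q)

-- Leading high letters join `us`. Behind the first low letter `y`, a high, a low and again a high
-- letter cannot follow one another: the two high letters give 2134 with `x`, `y` if they increase,
-- and the three letters give 2413 with `x` if the high ones decrease.
shape : ∀ xs → Unique (x ∷ xs) → Av Pattern𝕋 (x ∷ xs) → Shape x xs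
shape [] _ _ = skew [] []
shape {x} (y ∷ ys) ((x≢y ∷ x≢ys) ∷ y≢ys ∷ u) av with ℕ.<-cmp x y
... | tri≈ _ x≡y _ = contradiction x≡y x≢y
... | tri< x<y _ _ with shape ys (x≢ys ∷ u) (Av-⊆ (refl ∷ y ∷ʳ ⊆-refl) av)
...   | skew <us low<                = skew (x<y ∷ <us) low<
...   | inflated <us p< <ds q<       = inflated (x<y ∷ <us) p< <ds q<
shape {x} (y ∷ ys) ((x≢y ∷ x≢ys) ∷ y≢ys ∷ u) av | tri> _ _ y<x with blocks x≢ys contiguous
  where
  contiguous : b ∷ c ∷ d ∷ [] ⊆ ys → x < b → c < x → ¬ x < d
  contiguous {b} {c} {d} s x<b c<x x<d with ℕ.<-cmp b d
  ... | tri< b<d _ _ = av (refl ∷ refl ∷ ⊆-trans (refl ∷ _ ∷ʳ refl ∷ []) s) (p2134 y<x x<b b<d)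
  ... | tri> _ _ d<b = av (refl ∷ y ∷ʳ s) (p2413 c<x x<d d<b)
  ... | tri≈ _ b≡d _ = pair-resp-⊆ u (⊆-trans (refl ∷ _ ∷ʳ refl ∷ []) s) b≡d
... | p , []     , q , refl , p< , <ds , q< = skew [] (y<x ∷ All.++⁺ p< q<)
... | p , d ∷ ds , q , refl , p< , <ds , q< = inflated [] (y<x ∷ p<) <ds q<

-- The letter `x` marks the place of the collapsed block `ds`. Being the greatest letter, it makes
-- `(p , q)` the splitting of a member of `𝔸 (suc x)` at its maximum.
M : ℕ → List ℕ × List ℕ → Set
M x (p , q) = 𝔸 (suc x) (p ++ x ∷ q)

Perm-M⁻ : Perm 0 (suc x) (p ++ x ∷ q) → Perm 0 x (p ++ q)
Perm-M⁻ {x} {p} {q} π with Perm-resp-↭ (↭.shift x p q) π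
... | ρ with unique ρ
...   | x≢ ∷ _ = proj₁ (Perm-max⁻ ρ (All.tabulate λ v∈ →
  ℕ.≤∧≢⇒< (s≤s⁻¹ (proj₂ (sound ρ (there v∈)))) (All.lookup x≢ v∈ ∘ sym)))

Perm-M⁺ : Perm 0 x (p ++ q) → Perm 0 (suc x) (p ++ x ∷ q)
Perm-M⁺ {x} {p} {q} π = Perm-resp-↭ (↭-sym (↭.shift x p q)) (Perm-max⁺ π)

rearrange : ∀ us p ds q → x ∷ us ++ p ++ ds ++ q ↭ (p ++ q) ++ x ∷ (us ++ ds)
rearrange {x} us p ds q = ↭-trans (prep x (↭-trans
    (↭.++⁺ˡ us (↭.shifts p ds))
    (subst (_↭ (p ++ q) ++ us ++ ds) (++-assoc us ds (p ++ q)) (↭.++-comm (us ++ ds) (p ++ q)))))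
  (↭-sym (↭.shift x (p ++ q) (us ++ ds)))

-- The given permutation has a letter `f` of `ds` where `M` expects `x`. The map `g` fixes the
-- letters below `x` and sends `x` to `f`; it is increasing on letters up to `x`, so it carries
-- occurrences to occurrences.
Av-raise : All (_< x) p → All (_< x) q → x < f → Av Pattern𝕋 (p ++ f ∷ q) → Av Pattern𝕋 (p ++ x ∷ q)
Av-raise {x} {p} {q} {f} p<x q<x x<f av {zs} s β = av (subst (map g zs ⊆_) map≡ (⊆-map⁺ g s)) (raise β (All-resp-⊆ s ≤x))
  where
  g : ℕ → ℕ
  g v with v ℕ.<? x
  ... | yes _ = v
  ... | no  _ = f
  g-low : a < x → g a ≡ a
  g-low {a} a<x with a ℕ.<? x
  ... | yes _   = refl
  ... | no  a≮x = contradiction a<x a≮x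
  g-x : g x ≡ f
  g-x with x ℕ.<? x
  ... | yes x<x = contradiction x<x (ℕ.<-irrefl refl)
  ... | no  _   = refl
  map≡ : map g (p ++ x ∷ q) ≡ p ++ f ∷ q
  map≡ = trans (map-++ g p (x ∷ q)) (cong₂ _++_ (map-id-local (All.map g-low p<x))
    (cong₂ _∷_ g-x (map-id-local (All.map g-low q<x))))
  ≤x : All (_≤ x) (p ++ x ∷ q)
  ≤x = All.++⁺ (All.map ℕ.<⇒≤ p<x) (ℕ.≤-refl ∷ All.map ℕ.<⇒≤ q<x)
  g-mono : a < b → b ≤ x → g a < g b
  g-mono {a} {b} a<b b≤x with a ℕ.<? x | b ℕ.<? x
  ... | yes _   | yes _ = a<b
  ... | yes a<x | no _  = ℕ.<-trans a<x x<f
  ... | no a≮x  | _     = contradiction (ℕ.<-≤-trans a<b b≤x) a≮x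
  raise : ∀ {zs} → Pattern𝕋 zs → All (_≤ x) zs → Pattern𝕋 (map g zs)
  raise (p1342 a<d d<b b<c) (_ ∷ b≤ ∷ c≤ ∷ d≤ ∷ []) = p1342 (g-mono a<d d≤) (g-mono d<b b≤) (g-mono b<c c≤)
  raise (p2134 b<a a<c c<d) (a≤ ∷ _ ∷ c≤ ∷ d≤ ∷ []) = p2134 (g-mono b<a a≤) (g-mono a<c c≤) (g-mono c<d d≤)
  raise (p2413 c<a a<d d<b) (a≤ ∷ b≤ ∷ _ ∷ d≤ ∷ []) = p2413 (g-mono c<a a≤) (g-mono a<d d≤) (g-mono d<b b≤)

skew⁺ : V (suc x) (suc n) us → 𝔸 x low → 𝔸 (suc n) (x ∷ us ++ low)
skew⁺ {x} {us = us} {low} (π , av) (ρ , av′) =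
  Perm-resp-↭ (↭.++-comm low (x ∷ us)) (Perm-pivot⁺ ρ π) ,
  T-skew (ℕ.≤-refl ∷ All.map ℕ.<⇒≤ <us) (All< ρ ℕ.≤-refl) (T-∷-min <us av) av′
  where <us = <All π ℕ.≤-refl

inflated⁺ : Pairs (suc x) (suc n) (us , ds) → M x (p , q) → 𝔸 (suc n) (x ∷ us ++ p ++ ds ++ q)
inflated⁺ {us = us} {ds} {p} {q} (c , _ , (π , av) , (ρ , dec)) (σ , av′) =
  Perm-resp-↭ (↭-sym (rearrange us p ds q)) (Perm-pivot⁺ τ (Perm-++⁺ π ρ)) ,
  Inflate.av (All.++⁻ˡ p pq<) (<All ρ (bound π)) (All.++⁻ʳ p pq<) (<All π ℕ.≤-refl) dec
    (λ v∈ w∈ → ℕ.<-≤-trans (proj₂ (sound π v∈)) (proj₁ (sound ρ w∈))) av′ av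
  where
  τ   = Perm-M⁻ {p = p} σ
  pq< = All< τ ℕ.≤-refl

Skew Inflated : ℕ → ℕ → List ℕ → Set
Skew n x xs = ∃ λ ((us , low) : List ℕ × List ℕ) → (V (suc x) (suc n) us × 𝔸 x low) × xs ≡ x ∷ us ++ low
Inflated n x xs = ∃ λ (((us , ds) , (p , q)) : (List ℕ × List ℕ) × (List ℕ × List ℕ)) →
  (Pairs (suc x) (suc n) (us , ds) × M x (p , q) × p ≢ []) × xs ≡ x ∷ us ++ p ++ ds ++ q

skew⁻ : All (x <_) us → All (_< x) low → 𝔸 (suc n) (x ∷ us ++ low) → V (suc x) (suc n) us × 𝔸 x low
skew⁻ {x} {us} {low} <us low< (π , av) = (proj₂ parts , avV) , proj₁ parts , Av-⊆ (_ ∷ʳ ++⁺ˡ us ⊆-refl) av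
  where
  parts = Perm-pivot⁻ (Perm-resp-↭ (↭.++-comm (x ∷ us) low) π) low< <us
  avV : Av Pattern𝕍 us
  avV s (p231 c<a a<b)      = av (refl ∷ ++⁺ʳ low s) (p1342 (All.lookup <us (to∈ (∷ˡ⁻ (∷ˡ⁻ s)))) c<a a<b)
  avV s (p2134 b<a a<c c<d) = av (_ ∷ʳ ++⁺ʳ low s) (p2134 b<a a<c c<d)

module _ {x n us b p d ds q}
  (<us : All (x <_) us) (p< : All (_< x) (b ∷ p)) (<ds : All (x <_) (d ∷ ds)) (q< : All (_< x) q)
  (α : 𝔸 (suc n) (x ∷ us ++ (b ∷ p) ++ (d ∷ ds) ++ q)) where

  private
    av = proj₂ α

    parts : Perm 0 x ((b ∷ p) ++ q) × Perm (suc x) (suc n) (us ++ d ∷ ds)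
    parts = Perm-pivot⁻ (Perm-resp-↭ (rearrange us (b ∷ p) (d ∷ ds) q) (proj₁ α)) (All.++⁺ p< q<) (All.++⁺ <us <ds)

    -- The low letter `b` stands between the two blocks, so with `w < v` the letters `x`, `v`, `b`,
    -- `w` would form 2413.
    us<ds : ∀ {v w} → v ∈ us → w ∈ d ∷ ds → v < w
    us<ds {v} {w} v∈ w∈ with ℕ.<-cmp v w
    ... | tri< v<w _ _ = v<w
    ... | tri≈ _ v≡w _ = contradiction v≡w (pair-resp-⊆ (unique (proj₂ parts)) (++⁺ (from∈ v∈) (from∈ w∈)))
    ... | tri> _ _ w<v = ⊥-elim (av (refl ∷ ++⁺ (from∈ v∈) (refl ∷ ++⁺ˡ p (++⁺ʳ q (from∈ w∈))))
                          (p2413 (All.head p<) (All.lookup <ds w∈) w<v))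

    -- An ascent of the block would complete `x`, `b` to 2134.
    dec : Unique (d ∷ ds) → AllPairs _>_ (d ∷ ds)
    dec u = decreasing u λ s c<d →
      av (refl ∷ ++⁺ˡ us (refl ∷ ++⁺ˡ p (++⁺ʳ q s)))
         (p2134 (All.head p<) (All.lookup <ds (to∈ (⊆-trans (refl ∷ minimum _) s))) c<d)

    -- The smaller `x` in front turns 231 into 1342, and the larger `d` behind turns 213 into 2134.
    avW : Av Pattern𝕎 us
    avW s (p231 c<a a<b) = av (refl ∷ ++⁺ʳ _ s) (p1342 (All.lookup <us (to∈ (∷ˡ⁻ (∷ˡ⁻ s)))) c<a a<b)
    avW s (p213 b<a a<c) = av (_ ∷ʳ ++⁺ s (b ∷ʳ ++⁺ˡ p (refl ∷ minimum _)))
      (p2134 b<a a<c (us<ds (to∈ (∷ˡ⁻ (∷ˡ⁻ s))) (here refl)))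

  inflated⁻ : Pairs (suc x) (suc n) (us , d ∷ ds) × M x (b ∷ p , q) × _≢_ {A = List ℕ} (b ∷ p) []
  inflated⁻ = let c , π , ρ = Perm-++⁻ {xs = us} (proj₂ parts) us<ds in
      (c , ℕ.≤-<-trans (proj₁ (sound ρ (here refl))) (proj₂ (sound ρ (here refl))) , (π , avW) , ρ , dec (unique ρ))
    , (Perm-M⁺ {p = b ∷ p} (proj₁ parts)
      , Av-raise p< q< (All.head <ds) (Av-⊆ (_ ∷ʳ ++⁺ˡ us (refl ∷ ++⁺ ⊆-refl (refl ∷ ++⁺ˡ ds ⊆-refl))) av))
    , λ ()

decompose : 𝔸 (suc n) (x ∷ xs) → Skew n x (x ∷ xs) ⊎ Inflated n x (x ∷ xs)
decompose α with shape _ (unique (proj₁ α)) (proj₂ α)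
... | skew <us low<          = inj₁ (_ , skew⁻ <us low< α , refl)
... | inflated <us p< <ds q< = inj₂ (_ , inflated⁻ <us p< <ds q< α , refl)

M-split : M x (p , q) → All (_< x) p × All (_< x) q
M-split {p = p} (π , _) = All.++⁻ p (All< (Perm-M⁻ {p = p} π) ℕ.≤-refl)

M-injective : {pq pq′ : List ℕ × List ℕ} → M x pq → M x pq′ →
  proj₁ pq ++ x ∷ proj₂ pq ≡ proj₁ pq′ ++ x ∷ proj₂ pq′ → pq ≡ pq′
M-injective μ μ′ eq with ++-unique (proj₁ (M-split μ)) (proj₁ (M-split μ′)) (ℕ.<-irrefl refl ∷ _) (ℕ.<-irrefl refl ∷ _) eq
... | refl , eq′ = cong (_ ,_) (proj₂ (∷-injective eq′))

Skew-split : V (suc x) (suc n) us × 𝔸 x low → All (x <_) us × All (_< x) low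
Skew-split ((π , _) , (ρ , _)) = <All π ℕ.≤-refl , All< ρ ℕ.≤-refl

Inflated-split : Pairs (suc x) (suc n) (us , ds) × M x (p , q) × p ≢ [] →
  All (x <_) us × (All (_< x) p × p ≢ []) × (All (x <_) ds × ds ≢ []) × All (_< x) q
Inflated-split ((c , c<1+n , (π , _) , (ρ , _)) , μ , p≢[]) =
  <All π ℕ.≤-refl , (proj₁ (M-split μ) , p≢[]) ,
  (<All ρ (bound π) , λ { refl → ℕ.<⇒≢ c<1+n (sym (Perm-[]⁻ ρ)) }) , proj₂ (M-split μ)

stops-++ : {P : ℕ → Set} → xs ≢ [] → All (¬_ ∘ P) xs → Stops P (xs ++ ys)
stops-++ ≢[] []       = contradiction refl ≢[]
stops-++ _   (¬p ∷ _) = ¬p ∷ _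

low⇒¬high : All (_< x) xs → All (¬_ ∘ (x <_)) xs
low⇒¬high = All.map ℕ.<-asym

high⇒¬low : All (x <_) xs → All (¬_ ∘ (_< x)) xs
high⇒¬low = All.map ℕ.<-asym

private
  inflated-injective : ∀ {us′ ds′ p′ q′} →
    Pairs (suc x) (suc n) (us , ds) × M x (p , q) × p ≢ [] →
    Pairs (suc x) (suc n) (us′ , ds′) × M x (p′ , q′) × p′ ≢ [] →
    x ∷ us ++ p ++ ds ++ q ≡ x ∷ us′ ++ p′ ++ ds′ ++ q′ →
    ((us , ds) , (p , q)) ≡ ((us′ , ds′) , (p′ , q′))
  inflated-injective ι ι′ eq with Inflated-split ι | Inflated-split ι′
  ... | us< , (p< , p≢) , (<ds , ds≢) , q< | us<′ , (p<′ , p≢′) , (<ds′ , ds≢′) , q<′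
    with ++-unique us< us<′ (stops-++ p≢ (low⇒¬high p<)) (stops-++ p≢′ (low⇒¬high p<′)) (proj₂ (∷-injective eq))
  ... | refl , eq₁ with ++-unique p< p<′ (stops-++ ds≢ (high⇒¬low <ds)) (stops-++ ds≢′ (high⇒¬low <ds′)) eq₁
  ...   | refl , eq₂ with ++-unique <ds <ds′ (stops (low⇒¬high q<)) (stops (low⇒¬high q<′)) eq₂
  ...     | refl , refl = refl

-- The recurrence for the number of avoiders

module Recurrence (α : ℕ → ℕ) (Card-𝔸 : ∀ n → Card (𝔸 n) (α n)) where

  private
    -- The words with `p` empty are those of `𝔸 x` with the maximum `x` put in front, which creates
    -- no pattern because each pattern ends above its first letter.
    nonmax : ∀ x → ∃ λ b → α x + b ≡ α (suc x) × Card (λ (p , q) → M x (p , q) × p ≢ []) b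
    nonmax x = Card-∖ (λ { ([] , _) → yes refl ; (_ ∷ _ , _) → no λ () })
      (Card-preimage {P = M x} (λ (p , q) → p ++ x ∷ q) (Card-𝔸 (suc x)) id M-injective split)
      (Card-image ([] ,_) (Card-𝔸 x)
        (λ (π , av) → (Perm-M⁺ {p = []} π , T-skew (ℕ.≤-refl ∷ []) (All< π ℕ.≤-refl) (T-∷-min [] λ { [] () }) av) , refl)
        (λ { _ _ refl → refl })
        λ { {_ , _} ((π , av) , refl) → _ , (Perm-M⁻ {p = []} π , Av-∷⁻ av) , refl })
      where
      split : 𝔸 (suc x) ys → ∃ λ ((p , q) : List ℕ × List ℕ) → M x (p , q) × ys ≡ p ++ x ∷ q
      split (π , av) with ∈-∃++ (complete π z≤n ℕ.≤-refl)
      ... | p , q , refl = (p , q) , (π , av) , refl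

  β : ℕ → ℕ
  β x = proj₁ (nonmax x)

  α+β : ∀ x → α x + β x ≡ α (suc x)
  α+β x = proj₁ (proj₂ (nonmax x))

  -- The high letters fill `[suc x , suc n)`, hence the arguments `n ∸ x`. The shapes are disjoint
  -- because behind `us` a skew word has low letters only, while an inflated one still contains the
  -- nonempty high block `ds`.
  Card-first : ∀ {n} x → x ≤ n → Card (λ xs → Skew n x xs ⊎ Inflated n x xs)
    (countV (n ∸ x) ℕ.* α x + ∑ (n ∸ x) countW ℕ.* β x)
  Card-first {n} x x≤n = Card-⊎
    (Card-image (λ (us , low) → x ∷ us ++ low) (Card-× (Card-V (s≤s x≤n)) (Card-𝔸 x)) (λ p → _ , p , refl)
      (λ σ σ′ eq → let <us , low< = Skew-split σ ; <us′ , low<′ = Skew-split σ′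
                       eq₁ , eq₂ = ++-unique <us <us′ (stops (low⇒¬high low<)) (stops (low⇒¬high low<′)) (proj₂ (∷-injective eq))
                   in cong₂ _,_ eq₁ eq₂)
      id)
    (Card-image (λ ((us , ds) , (p , q)) → x ∷ us ++ p ++ ds ++ q)
      (Card-× (Card-Pairs (s≤s x≤n)) (proj₂ (proj₂ (nonmax x)))) (λ p → _ , p , refl)
      inflated-injective id)
    disjoint
    where
    disjoint : Skew n x xs → ¬ Inflated n x xs
    disjoint (_ , σ , refl) (((us , ds) , (p , q)) , ι , eq) with Skew-split σ | Inflated-split ι
    ... | <us , low< | <us′ , (p< , p≢) , (<ds , ds≢) , _
      with ++-unique <us <us′ (stops (low⇒¬high low<)) (stops-++ p≢ (low⇒¬high p<)) (proj₂ (∷-injective eq))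
    ...   | _ , refl = absurd <ds ds≢ (All.++⁻ˡ ds (All.++⁻ʳ p low<))
      where
      absurd : ∀ {ds} → All (x <_) ds → ds ≢ [] → ¬ All (_< x) ds
      absurd []        ≢[] _         = ≢[] refl
      absurd (x<d ∷ _) _   (d<x ∷ _) = ℕ.<-asym x<d d<x

  -- There is no circularity at `x = n`: `β n` involves `α (suc n)`, but its factor is the empty
  -- sum.
  recurrence : ∀ n → α (suc n) ≡ ∑ (suc n) (λ x → countV (n ∸ x) ℕ.* α x + ∑ (n ∸ x) countW ℕ.* β x)
  recurrence n = Card-unique (Card-𝔸 (suc n)) (Card-⇔
    (Card-∑ (suc n) {λ x xs → Skew n x xs ⊎ Inflated n x xs} _ (λ x x<1+n → Card-first x (s≤s⁻¹ x<1+n))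
      λ s s′ → proj₁ (∷-injective (trans (sym (proj₂ (head s))) (proj₂ (head s′)))))
    (λ { (x , _ , inj₁ (_ , (ω , α) , refl))     → skew⁺ ω α
       ; (x , _ , inj₂ (_ , (δ , μ , _) , refl)) → inflated⁺ δ μ })
    first)
    where
    head : Skew n x xs ⊎ Inflated n x xs → ∃ λ ys → xs ≡ x ∷ ys
    head (inj₁ (_ , _ , eq)) = _ , eq
    head (inj₂ (_ , _ , eq)) = _ , eq
    first : 𝔸 (suc n) xs → ∃ λ x → x < suc n × (Skew n x xs ⊎ Inflated n x xs)
    first {[]}     (π , _) = contradiction (Perm-[]⁻ π) λ ()
    first {x ∷ xs} a       = x , proj₂ (sound (proj₁ a) (here refl)) , decompose a

-- Power series

open ≡-Reasoning

-- Reduces the theorem to an identity of products. The constant terms give `h 0 ≡ f 0`; once that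
-- term is removed, `h ∘ suc` satisfies the equation of the next step of long division.
divide-unique : ∀ {g} f h (g₀≡1 : g 0 ≡ 1ℤ) → h * g ≈ f → h ≈ divide f g g₀≡1
divide-unique {g} f h g₀≡1 hg≈f zero = begin
  h 0                ≡⟨ ℤ.*-identityʳ (h 0) ⟨
  h 0 *ℤ 1ℤ          ≡⟨ cong (h 0 *ℤ_) g₀≡1 ⟨
  h 0 *ℤ g 0         ≡⟨ ℤ.+-identityʳ _ ⟨
  h 0 *ℤ g 0 +ℤ 0ℤ   ≡⟨ hg≈f 0 ⟩
  f 0                ∎
divide-unique {g} f h g₀≡1 hg≈f (suc n) = divide-unique _ (h ∘ suc) g₀≡1 tail≈ n
  where
  cancel : ∀ a b → b ≡ a +ℤ b -ℤ a
  cancel = solve-∀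
  tail≈ : (h ∘ suc) * g ≈ λ i → f (suc i) -ℤ f 0 *ℤ g (suc i)
  tail≈ i = begin
    ((h ∘ suc) * g) i                        ≡⟨ cancel (h 0 *ℤ g (suc i)) _ ⟩
    (h * g) (suc i) -ℤ h 0 *ℤ g (suc i)      ≡⟨ cong₂ (λ x y → x -ℤ y *ℤ g (suc i)) (hg≈f (suc i)) (divide-unique {g} f h g₀≡1 hg≈f zero) ⟩
    f (suc i) -ℤ f 0 *ℤ g (suc i)            ∎

-- By definition the product peels its left factor. Peeling the right one turns a shift of a
-- convolution into a shift of its kernel, where the recurrences for `countV` and `2 ^_` apply.
*-suc : ∀ h g n → (h * g) (suc n) ≡ h (suc n) *ℤ g 0 +ℤ (h * (g ∘ suc)) n
*-suc h g zero = swap (h 0 *ℤ g 1) (h 1 *ℤ g 0)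
  where
  swap : ∀ a b → a +ℤ (b +ℤ 0ℤ) ≡ b +ℤ (a +ℤ 0ℤ)
  swap = solve-∀
*-suc h g (suc n) = begin
  h 0 *ℤ g (suc (suc n)) +ℤ ((h ∘ suc) * g) (suc n)
    ≡⟨ cong (h 0 *ℤ g (suc (suc n)) +ℤ_) (*-suc (h ∘ suc) g n) ⟩
  h 0 *ℤ g (suc (suc n)) +ℤ (h (suc (suc n)) *ℤ g 0 +ℤ ((h ∘ suc) * (g ∘ suc)) n)
    ≡⟨ swap (h 0 *ℤ g (suc (suc n))) (h (suc (suc n)) *ℤ g 0) (((h ∘ suc) * (g ∘ suc)) n) ⟩
  h (suc (suc n)) *ℤ g 0 +ℤ (h * (g ∘ suc)) (suc n) ∎
  where
  swap : ∀ a b c → a +ℤ (b +ℤ c) ≡ b +ℤ (a +ℤ c)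
  swap = solve-∀

*-congʳ : ∀ {f g} h → f ≈ g → h * f ≈ h * g
*-congʳ h f≈g zero    = cong (λ x → h 0 *ℤ x +ℤ 0ℤ) (f≈g 0)
*-congʳ h f≈g (suc n) = cong₂ (λ x y → h 0 *ℤ x +ℤ y) (f≈g (suc n)) (*-congʳ (h ∘ suc) f≈g n)

*-linearʳ : ∀ k h f g n → (h * (λ i → k *ℤ f i +ℤ g i)) n ≡ k *ℤ (h * f) n +ℤ (h * g) n
*-linearʳ k h f g zero = distrib k (h 0) (f 0) (g 0)
  where
  distrib : ∀ k h f g → h *ℤ (k *ℤ f +ℤ g) +ℤ 0ℤ ≡ k *ℤ (h *ℤ f +ℤ 0ℤ) +ℤ (h *ℤ g +ℤ 0ℤ)
  distrib = solve-∀
*-linearʳ k h f g (suc n) = trans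
  (cong (h 0 *ℤ (k *ℤ f (suc n) +ℤ g (suc n)) +ℤ_) (*-linearʳ k (h ∘ suc) f g n))
  (distrib k (h 0) (f (suc n)) (g (suc n)) (((h ∘ suc) * f) n) (((h ∘ suc) * g) n))
  where
  distrib : ∀ k h f g x y → h *ℤ (k *ℤ f +ℤ g) +ℤ (k *ℤ x +ℤ y) ≡ k *ℤ (h *ℤ f +ℤ x) +ℤ (h *ℤ g +ℤ y)
  distrib = solve-∀

*-zeroʳ : ∀ h n → (h * polynomial []) n ≡ 0ℤ
*-zeroʳ h zero    = trans (ℤ.+-identityʳ _) (ℤ.*-zeroʳ (h 0))
*-zeroʳ h (suc n) = trans (cong₂ _+ℤ_ (ℤ.*-zeroʳ (h 0)) (*-zeroʳ (h ∘ suc) n)) refl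

∑-snoc : ∀ n f → ∑ (suc n) f ≡ ∑ n f ℕ.+ f n
∑-snoc zero    f = ℕ.+-comm (f 0) 0
∑-snoc (suc n) f = trans (cong (f 0 ℕ.+_) (∑-snoc n (f ∘ suc))) (sym (ℕ.+-assoc (f 0) _ _))

⟦_⟧ : (ℕ → ℕ) → PowerSeries
⟦ f ⟧ n = + f n

∑-* : ∀ m (f g f′ g′ : ℕ → ℕ) → + ∑ m (λ i → g i ℕ.* f i ℕ.+ g′ i ℕ.* f′ i) ≡
  sum {m} (λ i → + f (toℕ i) *ℤ + g (toℕ i)) +ℤ sum {m} (λ i → + f′ (toℕ i) *ℤ + g′ (toℕ i))
∑-* zero    f g f′ g′ = refl
∑-* (suc m) f g f′ g′ = begin
  + (g 0 ℕ.* f 0 ℕ.+ g′ 0 ℕ.* f′ 0) +ℤ + ∑ m _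
    ≡⟨ cong₂ _+ℤ_ (cong₂ _+ℤ_ (ℤ.pos-* (g 0) (f 0)) (ℤ.pos-* (g′ 0) (f′ 0)))
         (∑-* m (f ∘ suc) (g ∘ suc) (f′ ∘ suc) (g′ ∘ suc)) ⟩
  + g 0 *ℤ + f 0 +ℤ + g′ 0 *ℤ + f′ 0 +ℤ (S₁ +ℤ S₂)
    ≡⟨ shuffle (+ f 0) (+ g 0) (+ f′ 0) (+ g′ 0) S₁ S₂ ⟩
  (+ f 0 *ℤ + g 0 +ℤ S₁) +ℤ (+ f′ 0 *ℤ + g′ 0 +ℤ S₂) ∎
  where
  S₁ = sum {m} (λ i → + f (suc (toℕ i)) *ℤ + g (suc (toℕ i)))
  S₂ = sum {m} (λ i → + f′ (suc (toℕ i)) *ℤ + g′ (suc (toℕ i)))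
  shuffle : ∀ f g f′ g′ x y → g *ℤ f +ℤ g′ *ℤ f′ +ℤ (x +ℤ y) ≡ (f *ℤ g +ℤ x) +ℤ (f′ *ℤ g′ +ℤ y)
  shuffle = solve-∀

-- Elimination of the convolutions

module LinearSystem (A G T E D : ℕ → ℤ)
  (a : ∀ n → A (suc n) ≡ A n +ℤ G n +ℤ D n)
  (g : ∀ n → G (suc n) ≡ A n +ℤ (+ 2 *ℤ G n +ℤ T n))
  (t : ∀ n → T (suc n) ≡ T n +ℤ E n)
  (e : ∀ n → E (suc n) ≡ A n +ℤ + 2 *ℤ E n)
  (d : ∀ n → D (suc n) ≡ G n +ℤ + 3 *ℤ D n) where

  -- `G` and `D` enter `A` only through `S = G + D`, and `S (n + 1) = A n + T n + 3 S n`. So `A`,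
  -- `S`, `T`, `E` already form a closed system, which explains the order four; the coefficients are
  -- those of its characteristic polynomial `(z ^ 2 - 3 z + 2) (z ^ 2 - 4 z + 2) - 1`.
  eliminate : ∀ n →
    A (4 ℕ.+ n) *ℤ 1ℤ +ℤ (A (3 ℕ.+ n) *ℤ - + 7 +ℤ (A (2 ℕ.+ n) *ℤ + 16 +ℤ
    (A (1 ℕ.+ n) *ℤ - + 14 +ℤ (A n *ℤ + 3 +ℤ 0ℤ)))) ≡ 0ℤ
  eliminate n
    rewrite a (3 ℕ.+ n) | a (2 ℕ.+ n) | g (2 ℕ.+ n) | d (2 ℕ.+ n)
          | a (1 ℕ.+ n) | g (1 ℕ.+ n) | t (1 ℕ.+ n) | d (1 ℕ.+ n)
          | e n | a n | g n | t n | d n = lemma (A n) (G n) (T n) (E n) (D n)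
    where
    lemma : ∀ A G T E D →
      let A₁ = A +ℤ G +ℤ D
          G₁ = A +ℤ (+ 2 *ℤ G +ℤ T)
          T₁ = T +ℤ E
          D₁ = G +ℤ + 3 *ℤ D
          A₂ = A₁ +ℤ G₁ +ℤ D₁
          G₂ = A₁ +ℤ (+ 2 *ℤ G₁ +ℤ T₁)
          T₂ = T₁ +ℤ (A +ℤ + 2 *ℤ E)
          D₂ = G₁ +ℤ + 3 *ℤ D₁
          A₃ = A₂ +ℤ G₂ +ℤ D₂
          A₄ = A₃ +ℤ (A₂ +ℤ (+ 2 *ℤ G₂ +ℤ T₂)) +ℤ (G₂ +ℤ + 3 *ℤ D₂)
      in A₄ *ℤ 1ℤ +ℤ (A₃ *ℤ - + 7 +ℤ (A₂ *ℤ + 16 +ℤ (A₁ *ℤ - + 14 +ℤ (A *ℤ + 3 +ℤ 0ℤ)))) ≡ 0ℤ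
    lemma = solve-∀

  -- The small counts are run off the system, so only the count for the empty permutation is found
  -- by enumeration.
  initial : A 0 ≡ + 1 → G 0 ≡ + 1 → T 0 ≡ + 0 → E 0 ≡ + 1 → D 0 ≡ + 0 →
    A 1 ≡ + 2 × A 2 ≡ + 6 × A 3 ≡ + 21
  initial a₀ g₀ t₀ e₀ d₀
    rewrite a 2 | a 1 | g 1 | d 1 | a 0 | g 0 | t 0 | d 0 | a₀ | g₀ | t₀ | e₀ | d₀ = refl , refl , refl

*-congˡ : ∀ f g h n → (∀ i → i ℕ.≤ n → f i ≡ g i) → (f * h) n ≡ (g * h) n
*-congˡ f g h zero    eq = cong (λ x → x *ℤ h 0 +ℤ 0ℤ) (eq 0 ℕ.z≤n)
*-congˡ f g h (suc n) eq = cong₂ (λ x y → x *ℤ h (suc n) +ℤ y) (eq 0 ℕ.z≤n)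
  (*-congˡ (f ∘ suc) (g ∘ suc) h n λ i i≤n → eq (suc i) (ℕ.s≤s i≤n))

2^-suc : ∀ m → 2 ^ suc m ≡ 2 ^ m ℕ.+ 2 ^ m
2^-suc m = cong (2 ^ m ℕ.+_) (ℕ.+-identityʳ (2 ^ m))

∑-countW : ∀ m → ∑ (suc m) countW ≡ 2 ^ m
∑-countW zero    = refl
∑-countW (suc m) = trans (∑-snoc (suc m) countW) (trans (cong (ℕ._+ 2 ^ m) (∑-countW m)) (sym (2^-suc m)))

denominator : PowerSeries
denominator = polynomial (+ 1 ∷ - + 7 ∷ + 16 ∷ - + 14 ∷ + 3 ∷ [])

numerator : PowerSeries
numerator = polynomial (+ 1 ∷ - + 1 ∷ []) * polynomial (+ 1 ∷ - + 2 ∷ []) * polynomial (+ 1 ∷ - + 3 ∷ [])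

*-polynomial : ∀ h c cs n → (h * polynomial (c ∷ cs)) (suc n) ≡ h (suc n) *ℤ c +ℤ (h * polynomial cs) n
*-polynomial h c cs n = *-suc h (polynomial (c ∷ cs)) n

*-linear-factor : ∀ h c d n → h (2 ℕ.+ n) ≡ 0ℤ → h (1 ℕ.+ n) ≡ 0ℤ →
  (h * polynomial (c ∷ d ∷ [])) (2 ℕ.+ n) ≡ 0ℤ
*-linear-factor h c d n h₂ h₁ = begin
  (h * polynomial (c ∷ d ∷ [])) (2 ℕ.+ n)
    ≡⟨ *-polynomial h c (d ∷ []) (1 ℕ.+ n) ⟩
  h (2 ℕ.+ n) *ℤ c +ℤ (h * polynomial (d ∷ [])) (1 ℕ.+ n)
    ≡⟨ cong (h (2 ℕ.+ n) *ℤ c +ℤ_) (*-polynomial h d [] n) ⟩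
  h (2 ℕ.+ n) *ℤ c +ℤ (h (1 ℕ.+ n) *ℤ d +ℤ (h * polynomial []) n)
    ≡⟨ cong₂ (λ x y → x *ℤ c +ℤ (y *ℤ d +ℤ (h * polynomial []) n)) h₂ h₁ ⟩
  0ℤ +ℤ (0ℤ +ℤ (h * polynomial []) n)
    ≡⟨ cong (λ x → 0ℤ +ℤ (0ℤ +ℤ x)) (*-zeroʳ h n) ⟩
  0ℤ ∎

numerator-vanishes : ∀ n → numerator (5 ℕ.+ n) ≡ 0ℤ
numerator-vanishes n = *-linear-factor
  (polynomial (+ 1 ∷ - + 1 ∷ []) * polynomial (+ 1 ∷ - + 2 ∷ [])) (+ 1) (- + 3) (3 ℕ.+ n)
  (quadratic (2 ℕ.+ n)) (quadratic (1 ℕ.+ n))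
  where
  quadratic : ∀ n → (polynomial (+ 1 ∷ - + 1 ∷ []) * polynomial (+ 1 ∷ - + 2 ∷ [])) (3 ℕ.+ n) ≡ 0ℤ
  quadratic n = *-linear-factor (polynomial (+ 1 ∷ - + 1 ∷ [])) (+ 1) (- + 2) (1 ℕ.+ n) refl refl

module Series (α β : ℕ → ℕ) (α+β : ∀ n → α n ℕ.+ β n ≡ α (suc n))
  (recurrence : ∀ n → α (suc n) ≡ ∑ (suc n) (λ x → countV (n ∸ x) ℕ.* α x ℕ.+ ∑ (n ∸ x) countW ℕ.* β x))
  (α₀ : α 0 ≡ 1) where

  t : ℕ → ℕ
  t m = ∑ m (2 ^_)

  -- The kernels are closed under shifting: `countV ∘ suc` becomes twice itself plus `t`, `t` gains
  -- `2 ^_`, and `2 ^_` doubles. Hence finitely many convolutions suffice.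
  α₊ G G′ T E βP D : PowerSeries
  α₊  = ⟦ α ∘ suc ⟧
  G  = ⟦ α ⟧ * ⟦ countV ⟧
  G′ = ⟦ α ⟧ * ⟦ countV ∘ suc ⟧
  T  = ⟦ α ⟧ * ⟦ t ⟧
  E  = ⟦ α ⟧ * ⟦ 2 ^_ ⟧
  βP  = ⟦ β ⟧ * ⟦ (λ m → ∑ m countW) ⟧
  D  = ⟦ β ⟧ * ⟦ 2 ^_ ⟧

  α₊≡G+βP : ∀ n → α₊ n ≡ G n +ℤ βP n
  α₊≡G+βP n = trans (cong +_ (recurrence n)) (∑-* (suc n) α (λ x → countV (n ∸ x)) β (λ x → ∑ (n ∸ x) countW))

  G-suc : ∀ n → G (suc n) ≡ α₊ n +ℤ G′ n
  G-suc n = trans (*-suc ⟦ α ⟧ ⟦ countV ⟧ n) (cong (_+ℤ G′ n) (ℤ.*-identityʳ (α₊ n)))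

  G′-suc : ∀ n → G′ (suc n) ≡ α₊ n +ℤ (+ 2 *ℤ G′ n +ℤ T n)
  G′-suc n = trans (*-suc ⟦ α ⟧ ⟦ countV ∘ suc ⟧ n) (cong₂ _+ℤ_ (ℤ.*-identityʳ (α₊ n))
    (trans (*-congʳ ⟦ α ⟧ countV-suc n) (*-linearʳ (+ 2) ⟦ α ⟧ ⟦ countV ∘ suc ⟧ ⟦ t ⟧ n)))
    where
    double : ∀ x y → x +ℤ (x +ℤ y) ≡ + 2 *ℤ x +ℤ y
    double = solve-∀
    countV-suc : ⟦ countV ∘ ℕ.suc ∘ ℕ.suc ⟧ ≈ λ m → + 2 *ℤ ⟦ countV ∘ suc ⟧ m +ℤ ⟦ t ⟧ m
    countV-suc m = double (+ countV (suc m)) (+ t m)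

  one* : ∀ f g h n → (h * (λ i → f i +ℤ g i)) n ≡ (h * f) n +ℤ (h * g) n
  one* f g h n = trans (*-congʳ h (λ i → cong (_+ℤ g i) (sym (ℤ.*-identityˡ (f i)))) n)
    (trans (*-linearʳ 1ℤ h f g n) (cong (_+ℤ (h * g) n) (ℤ.*-identityˡ ((h * f) n))))

  T-suc : ∀ n → T (suc n) ≡ T n +ℤ E n
  T-suc n = begin
    T (suc n)                              ≡⟨ *-suc ⟦ α ⟧ ⟦ t ⟧ n ⟩
    α₊ n *ℤ 0ℤ +ℤ (⟦ α ⟧ * ⟦ t ∘ suc ⟧) n   ≡⟨ cong₂ _+ℤ_ (ℤ.*-zeroʳ (α₊ n)) (*-congʳ ⟦ α ⟧ (λ m → cong +_ (∑-snoc m (2 ^_))) n) ⟩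
    0ℤ +ℤ (⟦ α ⟧ * (λ m → + t m +ℤ + (2 ^ m))) n ≡⟨ ℤ.+-identityˡ _ ⟩
    (⟦ α ⟧ * (λ m → + t m +ℤ + (2 ^ m))) n ≡⟨ one* ⟦ t ⟧ ⟦ 2 ^_ ⟧ ⟦ α ⟧ n ⟩
    T n +ℤ E n                             ∎

  2^-step : ∀ h n → (h * ⟦ 2 ^_ ⟧) (suc n) ≡ h (suc n) +ℤ + 2 *ℤ (h * ⟦ 2 ^_ ⟧) n
  2^-step h n = trans (*-suc h ⟦ 2 ^_ ⟧ n) (cong₂ _+ℤ_ (ℤ.*-identityʳ (h (suc n)))
    (trans (*-congʳ h (λ m → cong +_ (2^-suc m)) n)
      (trans (one* ⟦ 2 ^_ ⟧ ⟦ 2 ^_ ⟧ h n) (double _))))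
    where
    double : ∀ x → x +ℤ x ≡ + 2 *ℤ x
    double = solve-∀

  βP-suc : ∀ n → βP (suc n) ≡ D n
  βP-suc n = trans (*-suc ⟦ β ⟧ ⟦ (λ m → ∑ m countW) ⟧ n)
    (trans (cong₂ _+ℤ_ (ℤ.*-zeroʳ (+ β (suc n))) (*-congʳ ⟦ β ⟧ (λ m → cong +_ (∑-countW m)) n)) (ℤ.+-identityˡ _))

  α₊-suc : ∀ n → α₊ (suc n) ≡ α₊ n +ℤ G′ n +ℤ D n
  α₊-suc n = trans (α₊≡G+βP (suc n)) (cong₂ _+ℤ_ (G-suc n) (βP-suc n))

  -- Here `β` leaves the system: as a difference of `α` it equals `G′ n +ℤ D n` at `suc n`, which
  -- raises the factor 2 of the kernel to 3.
  D-suc : ∀ n → D (suc n) ≡ G′ n +ℤ + 3 *ℤ D n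
  D-suc n = begin
    D (suc n)                         ≡⟨ 2^-step ⟦ β ⟧ n ⟩
    + β (suc n) +ℤ + 2 *ℤ D n         ≡⟨ difference (α₊ n) (+ β (suc n)) (D n) ⟩
    α₊ n +ℤ + β (suc n) -ℤ α₊ n +ℤ + 2 *ℤ D n ≡⟨ cong (λ x → x -ℤ α₊ n +ℤ + 2 *ℤ D n) (trans (cong +_ (α+β (suc n))) (α₊-suc n)) ⟩
    α₊ n +ℤ G′ n +ℤ D n -ℤ α₊ n +ℤ + 2 *ℤ D n ≡⟨ collect (α₊ n) (G′ n) (D n) ⟩
    G′ n +ℤ + 3 *ℤ D n                ∎
    where
    difference : ∀ a b d → b +ℤ + 2 *ℤ d ≡ a +ℤ b -ℤ a +ℤ + 2 *ℤ d
    difference = solve-∀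
    collect : ∀ a g d → a +ℤ g +ℤ d -ℤ a +ℤ + 2 *ℤ d ≡ g +ℤ + 3 *ℤ d
    collect = solve-∀

  expand : ∀ n → (⟦ α ⟧ * denominator) (5 ℕ.+ n) ≡
    α₊ (4 ℕ.+ n) *ℤ 1ℤ +ℤ (α₊ (3 ℕ.+ n) *ℤ - + 7 +ℤ (α₊ (2 ℕ.+ n) *ℤ + 16 +ℤ
    (α₊ (1 ℕ.+ n) *ℤ - + 14 +ℤ (α₊ n *ℤ + 3 +ℤ 0ℤ))))
  expand n =
    trans (*-polynomial ⟦ α ⟧ _ _ (4 ℕ.+ n)) (cong (α₊ (4 ℕ.+ n) *ℤ 1ℤ +ℤ_)
    (trans (*-polynomial ⟦ α ⟧ _ _ (3 ℕ.+ n)) (cong (α₊ (3 ℕ.+ n) *ℤ - + 7 +ℤ_)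
    (trans (*-polynomial ⟦ α ⟧ _ _ (2 ℕ.+ n)) (cong (α₊ (2 ℕ.+ n) *ℤ + 16 +ℤ_)
    (trans (*-polynomial ⟦ α ⟧ _ _ (1 ℕ.+ n)) (cong (α₊ (1 ℕ.+ n) *ℤ - + 14 +ℤ_)
    (trans (*-polynomial ⟦ α ⟧ _ _ n) (cong (α₊ n *ℤ + 3 +ℤ_)
    (*-zeroʳ ⟦ α ⟧ n))))))))))

  α₁ : α₊ 0 ≡ 1ℤ
  α₁ = trans (α₊≡G+βP 0) (cong₂ (λ x y → x *ℤ 1ℤ +ℤ 0ℤ +ℤ (y +ℤ 0ℤ)) (cong +_ α₀) (ℤ.*-zeroʳ (+ β 0)))

  β₀ : β 0 ≡ 0
  β₀ = ℕ.+-cancelˡ-≡ 1 _ _ (trans (cong (ℕ._+ β 0) (sym α₀)) (trans (α+β 0) (ℤ.+-injective α₁)))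

  open LinearSystem α₊ G′ T E D α₊-suc G′-suc T-suc (2^-step ⟦ α ⟧) D-suc

  values : PowerSeries
  values = polynomial (+ 1 ∷ + 1 ∷ + 2 ∷ + 6 ∷ + 21 ∷ [])

  α-values : ∀ i → i ℕ.< 5 → ⟦ α ⟧ i ≡ values i
  α-values 0 _ = cong +_ α₀
  α-values 1 _ = α₁
  α-values (suc (suc i)) i<5 = later i i<5
    where
    first : α₊ 1 ≡ + 2 × α₊ 2 ≡ + 6 × α₊ 3 ≡ + 21
    first = initial α₁
      (cong (λ x → x *ℤ 1ℤ +ℤ 0ℤ) (cong +_ α₀))
      (cong (λ x → x *ℤ 0ℤ +ℤ 0ℤ) (cong +_ α₀))
      (cong (λ x → x *ℤ 1ℤ +ℤ 0ℤ) (cong +_ α₀))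
      (cong (λ x → x *ℤ 1ℤ +ℤ 0ℤ) (cong +_ β₀))
    later : ∀ i → 2 ℕ.+ i ℕ.< 5 → ⟦ α ⟧ (2 ℕ.+ i) ≡ values (2 ℕ.+ i)
    later 0 _ = proj₁ first
    later 1 _ = proj₁ (proj₂ first)
    later 2 _ = proj₂ (proj₂ first)
    later (suc (suc (suc i))) (ℕ.s≤s (ℕ.s≤s (ℕ.s≤s (ℕ.s≤s (ℕ.s≤s ())))))

  -- A coefficient below index 5 involves only the first five counts, so the polynomial `values` may
  -- stand in for `⟦ α ⟧` and the comparison becomes a computation.
  initially : ∀ n → n ℕ.< 5 → (values * denominator) n ≡ numerator n → (⟦ α ⟧ * denominator) n ≡ numerator n
  initially n n<5 = trans (*-congˡ ⟦ α ⟧ values denominator n λ i i≤n → α-values i (ℕ.≤-<-trans i≤n n<5))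

  -- `eliminate` relates five consecutive values of the shifted sequence `α₊`, so it settles the
  -- coefficients from 5 on.
  product : ⟦ α ⟧ * denominator ≈ numerator
  product 0 = initially 0 (ℕ.≤ᵇ⇒≤ 1 5 _) refl
  product 1 = initially 1 (ℕ.≤ᵇ⇒≤ 2 5 _) refl
  product 2 = initially 2 (ℕ.≤ᵇ⇒≤ 3 5 _) refl
  product 3 = initially 3 (ℕ.≤ᵇ⇒≤ 4 5 _) refl
  product 4 = initially 4 (ℕ.≤ᵇ⇒≤ 5 5 _) refl
  product (suc (suc (suc (suc (suc n))))) =
    trans (expand n) (trans (eliminate n) (sym (numerator-vanishes n)))

-- From words to lists

letters : Word m n → List ℕ
letters w = tabulate (toℕ ∘ lookup w)

letters-injective : (w w′ : Word m n) → letters w ≡ letters w′ → w ≡ w′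
letters-injective []      []        eq = refl
letters-injective (x ∷ w) (x′ ∷ w′) eq with ∷-injective eq
... | x≡x′ , eq′ = cong₂ _∷_ (Fin.toℕ-injective x≡x′) (letters-injective w w′ eq′)

letters-surjective : ∀ {xs} → All (_< m) xs → ∃ λ (w : Word m (length xs)) → xs ≡ letters w
letters-surjective []          = [] , refl
letters-surjective (x<m ∷ xs<m) with letters-surjective xs<m
... | w , eq = fromℕ< x<m ∷ w , cong₂ _∷_ (sym (Fin.toℕ-fromℕ< x<m)) eq

positive : {ι : Vec (Fin (suc n)) k} → VecAll.All (zero {n} <ᶠ_) ι → ∃ λ ι′ → ι ≡ Vec.map suc ι′
positive {ι = []}        []       = [] , refl
positive {ι = suc i ∷ ι} (_ ∷ ps) with positive ps
... | ι′ , refl = i ∷ ι′ , refl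

private
  AllPairs-suc⁻ : (ι : Vec (Fin n) k) → VecPairs.AllPairs _<ᶠ_ (Vec.map suc ι) → VecPairs.AllPairs _<ᶠ_ ι
  AllPairs-suc⁻ []      []       = []
  AllPairs-suc⁻ (i ∷ ι) (p ∷ ps) = VecAll.map ℕ.s≤s⁻¹ (VecAll.map⁻ p) ∷ AllPairs-suc⁻ ι ps

select : Word m n → Vec (Fin n) k → Vec ℕ k
select w = Vec.map (toℕ ∘ lookup w)

select-suc : ∀ (x : Fin m) (w : Word m n) (ι : Vec (Fin n) k) → select (x ∷ w) (Vec.map suc ι) ≡ select w ι
select-suc x w ι = sym (Vec.map-∘ (toℕ ∘ lookup (x ∷ w)) suc ι)

-- In an increasing index vector only the head can be `zero`. If it is, the first letter of the word
-- is taken; otherwise all indices are successors and the letter is skipped.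
select⇒⊆ : (w : Word m n) (ι : Vec (Fin n) k) → VecPairs.AllPairs _<ᶠ_ ι → Vec.toList (select w ι) ⊆ letters w
select⇒⊆ w       []           _        = minimum _
select⇒⊆ (x ∷ w) (zero ∷ ι) (p ∷ ps) with positive p
... | ι′ , refl = refl ∷ subst (λ u → Vec.toList u ⊆ letters w) (sym (select-suc x w ι′)) (select⇒⊆ w ι′ (AllPairs-suc⁻ ι′ ps))
select⇒⊆ (x ∷ w) (suc i ∷ ι) (p ∷ ps) with positive (VecAll.map (ℕ.≤-<-trans z≤n) p)
... | ι′ , refl = _ ∷ʳ subst (λ u → Vec.toList u ⊆ letters w) (sym (select-suc x w (i ∷ ι′)))
  (select⇒⊆ w (i ∷ ι′) (AllPairs-suc⁻ (i ∷ ι′) (p ∷ ps)))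

⊆⇒select : (w : Word m n) (u : Vec ℕ k) → Vec.toList u ⊆ letters w →
  ∃ λ ι → VecPairs.AllPairs _<ᶠ_ ι × select w ι ≡ u
⊆⇒select w       []      _          = [] , [] , refl
⊆⇒select (x ∷ w) u@(_ ∷ _) (_ ∷ʳ s) with ⊆⇒select w u s
... | ι , ι< , eq = Vec.map suc ι , VecPairs.map⁺ (VecPairs.map s≤s ι<) , trans (select-suc x w ι) eq
⊆⇒select (x ∷ w) (y ∷ u) (refl ∷ s) with ⊆⇒select w u s
... | ι , ι< , eq = zero ∷ Vec.map suc ι
  , VecAll.map⁺ (VecAll.universal (λ _ → s≤s z≤n) ι) ∷ VecPairs.map⁺ (VecPairs.map s≤s ι<)
  , cong (toℕ x ∷_) (trans (select-suc x w ι) eq)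

lookup-mono : {s : Vec ℕ k} → VecPairs.AllPairs _<_ s → ∀ {i j} → i <ᶠ j → lookup s i < lookup s j
lookup-mono (p ∷ ps) {zero}  {suc j} _         = VecAll.lookup⁺ p j
lookup-mono (p ∷ ps) {suc i} {suc j} (s≤s i<j) = lookup-mono ps i<j

lookup-mono⁻ : {s : Vec ℕ k} → VecPairs.AllPairs _<_ s → ∀ {i j} → lookup s i < lookup s j → i <ᶠ j
lookup-mono⁻ s< {i} {j} sᵢ<sⱼ with Fin.<-cmp i j
... | tri< i<j _ _  = i<j
... | tri≈ _ refl _ = contradiction sᵢ<sⱼ (ℕ.<-irrefl refl)
... | tri> _ _ j<i  = contradiction sᵢ<sⱼ (ℕ.<-asym (lookup-mono s< j<i))

-- A word is given by its sorted values `s` and the ranks `r` of its letters; the order type depends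
-- on the ranks alone.
orderIsomorphic : {s t : Vec ℕ m} → VecPairs.AllPairs _<_ s → VecPairs.AllPairs _<_ t → (r : Vec (Fin m) k) →
  OrderIsomorphic (Vec.map (lookup s) r) (Vec.map (lookup t) r)
orderIsomorphic {s = s} {t} s< t< r i j
  rewrite Vec.lookup-map i (lookup s) r | Vec.lookup-map j (lookup s) r
        | Vec.lookup-map i (lookup t) r | Vec.lookup-map j (lookup t) r =
  mk⇔ (lookup-mono t< ∘ lookup-mono⁻ s<) (lookup-mono s< ∘ lookup-mono⁻ t<)

1342′ 2134′ 2413′ : Vec ℕ 4
1342′ = 1 ∷ 3 ∷ 4 ∷ 2 ∷ []
2134′ = 2 ∷ 1 ∷ 3 ∷ 4 ∷ []
2413′ = 2 ∷ 4 ∷ 1 ∷ 3 ∷ []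

𝕋 : List Pattern
𝕋 = (4 , 1342′) ∷ (4 , 2134′) ∷ (4 , 2413′) ∷ []

private
  chain : a < b → b < c → c < d → VecPairs.AllPairs _<_ (a ∷ b ∷ c ∷ d ∷ [])
  chain a<b b<c c<d = (a<b ∷ ℕ.<-trans a<b b<c ∷ ℕ.<-trans a<b (ℕ.<-trans b<c c<d) ∷ []) ∷
    (b<c ∷ ℕ.<-trans b<c c<d ∷ []) ∷ (c<d ∷ []) ∷ [] ∷ []

  1234< : VecPairs.AllPairs _<_ (1 ∷ 2 ∷ 3 ∷ 4 ∷ [])
  1234< = chain ℕ.≤-refl ℕ.≤-refl ℕ.≤-refl

  pattern 0F = zero
  pattern 1F = suc 0F
  pattern 2F = suc 1F
  pattern 3F = suc 2F

  contains : (π : Word n n) (τ u : Vec ℕ k) → OrderIsomorphic u τ → Vec.toList u ⊆ letters π → Contains π τ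
  contains π τ u oi s with ⊆⇒select π u s
  ... | ι , ι< , refl = ι , ι< , oi

InS⇒Av : (π : Word n n) → All (Avoids π) 𝕋 → Av Pattern𝕋 (letters π)
InS⇒Av π (av₁ ∷ av₂ ∷ av₃ ∷ []) s (p1342 a<d d<b b<c) =
  -- The index vector lists ranks counted from 0, so 1342 is written 0, 2, 3, 1.
  av₁ (contains π 1342′ (_ ∷ _ ∷ _ ∷ _ ∷ []) (orderIsomorphic (chain a<d d<b b<c) 1234< (0F ∷ 2F ∷ 3F ∷ 1F ∷ [])) s)
InS⇒Av π (av₁ ∷ av₂ ∷ av₃ ∷ []) s (p2134 b<a a<c c<d) =
  av₂ (contains π 2134′ (_ ∷ _ ∷ _ ∷ _ ∷ []) (orderIsomorphic (chain b<a a<c c<d) 1234< (1F ∷ 0F ∷ 2F ∷ 3F ∷ [])) s)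
InS⇒Av π (av₁ ∷ av₂ ∷ av₃ ∷ []) s (p2413 c<a a<d d<b) =
  av₃ (contains π 2413′ (_ ∷ _ ∷ _ ∷ _ ∷ []) (orderIsomorphic (chain c<a a<d d<b) 1234< (1F ∷ 3F ∷ 0F ∷ 2F ∷ [])) s)

Av⇒InS : (π : Word n n) → Av Pattern𝕋 (letters π) → All (Avoids π) 𝕋
Av⇒InS π av =
  (λ { (ι@(_ ∷ _ ∷ _ ∷ _ ∷ []) , ι< , oi) → av (select⇒⊆ π ι ι<)
       -- Only letters of adjacent value in the pattern are compared; these values differ by one, so
       -- `ℕ.≤-refl` proves the inequality.
       (p1342 (Equivalence.from (oi 0F 3F) ℕ.≤-refl)
             (Equivalence.from (oi 3F 1F) ℕ.≤-refl)
             (Equivalence.from (oi 1F 2F) ℕ.≤-refl)) }) ∷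
  (λ { (ι@(_ ∷ _ ∷ _ ∷ _ ∷ []) , ι< , oi) → av (select⇒⊆ π ι ι<)
       (p2134 (Equivalence.from (oi 1F 0F) ℕ.≤-refl)
             (Equivalence.from (oi 0F 2F) ℕ.≤-refl)
             (Equivalence.from (oi 2F 3F) ℕ.≤-refl)) }) ∷
  (λ { (ι@(_ ∷ _ ∷ _ ∷ _ ∷ []) , ι< , oi) → av (select⇒⊆ π ι ι<)
       (p2413 (Equivalence.from (oi 2F 0F) ℕ.≤-refl)
             (Equivalence.from (oi 0F 3F) ℕ.≤-refl)
             (Equivalence.from (oi 3F 1F) ℕ.≤-refl)) }) ∷ []

IsPermutation⇒Perm : (π : Word n n) → IsPermutation π → Perm 0 n (letters π)
IsPermutation⇒Perm π (injective , surjective) = perm z≤n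
  (Unique.tabulate⁺ (injective ∘ Fin.toℕ-injective))
  (λ v∈ → z≤n , let i , eq = ∈-tabulate⁻ v∈ in subst (_< _) (sym eq) (Fin.toℕ<n (lookup π i)))
  λ _ v<n → let i , eq = surjective (fromℕ< v<n) in
    subst (_∈ letters π) (trans (cong toℕ (eq refl)) (Fin.toℕ-fromℕ< v<n)) (∈-tabulate⁺ i)

Perm⇒IsPermutation : (π : Word n n) → Perm 0 n (letters π) → IsPermutation π
Perm⇒IsPermutation π ρ = injective , surjective
  where
  distinct : ∀ {i j} → i <ᶠ j → lookup π i ≢ lookup π j
  distinct {i} {j} i<j = pair-resp-⊆ (unique ρ) (select⇒⊆ π (i ∷ j ∷ []) ((i<j ∷ []) ∷ [] ∷ [])) ∘ cong toℕ
  injective : ∀ {i j} → lookup π i ≡ lookup π j → i ≡ j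
  injective {i} {j} eq with Fin.<-cmp i j
  ... | tri< i<j _ _ = contradiction eq (distinct i<j)
  ... | tri≈ _ i≡j _ = i≡j
  ... | tri> _ _ j<i = contradiction (sym eq) (distinct j<i)
  surjective : ∀ y → ∃ λ x → ∀ {z} → z ≡ x → lookup π z ≡ y
  surjective y with ∈-tabulate⁻ (complete ρ z≤n (Fin.toℕ<n y))
  ... | i , eq = i , λ { refl → Fin.toℕ-injective (sym eq) }

Perm-length : ∀ {xs} → Perm 0 n xs → length xs ≡ n
Perm-length {n} {xs} π = Card-unique
  (card xs (unique π) (proj₂ ∘ sound π) (complete π z≤n) refl)
  (card (upTo n) (Unique.upTo⁺ n) ∈-upTo⁻ ∈-upTo⁺ (length-upTo n))

Card-InS : ∀ n → Card (InS {n} 𝕋) (length (S n 𝕋))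
Card-InS n = card (S n 𝕋) (S-unique n 𝕋) (Equivalence.to ∈-S) (Equivalence.from ∈-S) refl

Card-𝔸 : ∀ n → Card (𝔸 n) (length (S n 𝕋))
Card-𝔸 n = Card-image letters (Card-InS n)
  (λ {π} (bij , av) → IsPermutation⇒Perm π bij , InS⇒Av π av)
  (λ _ _ → letters-injective _ _)
  surj
  where
  surj : ∀ {xs} → 𝔸 n xs → ∃ λ π → InS 𝕋 π × xs ≡ letters π
  surj (ρ , av) with Perm-length ρ
  ... | refl with letters-surjective (All.tabulate (proj₂ ∘ sound ρ))
  ...   | π , eq = π , (Perm⇒IsPermutation π (subst (Perm 0 _) eq ρ) , Av⇒InS π (subst (Av Pattern𝕋) eq av)) , eq

length-S-0 : length (S 0 𝕋) ≡ 1
length-S-0 = refl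

theorem24 : F ( (4 , 1 ∷ 3 ∷ 4 ∷ 2 ∷ [])
    ∷ (4 , 2 ∷ 1 ∷ 3 ∷ 4 ∷ [])
    ∷ (4 , 2 ∷ 4 ∷ 1 ∷ 3 ∷ [])
    ∷ [])
    ≈ divide
    (polynomial (+ 1 ∷ - + 1 ∷ []) * polynomial (+ 1 ∷ - + 2 ∷ []) * polynomial (+ 1 ∷ - + 3 ∷ []))
    (polynomial (+ 1 ∷ - + 7 ∷ + 16 ∷ - + 14 ∷ + 3 ∷ []))
    refl
theorem24 = divide-unique numerator (F 𝕋) refl product
  where
  open Recurrence (λ n → length (S n 𝕋)) Card-𝔸
  open Series (λ n → length (S n 𝕋)) β α+β recurrence length-S-0
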